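{- Let $\alpha=(a_1,\ldots,a_n)\in PP_n$ and suppose that all cars follow the $k$-Naples parking rule, with $k\ge 1$. Let $[p,q]\subseteq U_\alpha$ be a maximal interval. The following are equivalent: (i) restricting to the cars having preference at least $p$ (that is, running the $k$-Naples parking process on the street with spots $1,\ldots,n$ only with the cars $c_i$ with $a_i\ge p$, in their original order), spot $p-1$ is occupied by some car; (ii) there exists $J\subseteq[n]$, with $|J|\ge q-p+2$ and $a_j\in[p,\,p-2+|J|]$ for all $j\in J$, such that $\tau_{p-2}(\alpha_{|_J})\in PF_{|J|,k}$ is a complete $k$-Naples parking function. Each of these conditions is guaranteed to be satisfied when $|[p,q]|\le k$ (where $|[p,q]|=q-p+1$). Moreover, $\alpha\in PF_{n,k}$ if and only if all maximal intervals of $U_\alpha$ having size at least $k+1$ satisfy any of the (equivalent) conditions (i), (ii).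
   Context: For integers $a\le b$, $[a,b]=\{a,\ldots,b\}$ (empty if $a>b$) and $[n]=[1,n]$. A parking preference of length $n$ is a tuple $\alpha=(a_1,\ldots,a_n)$ with entries in $[n]$; $PP_n$ is the set of these. Cars $c_1,\ldots,c_n$ arrive in this order at a one-way street with spots $1,\ldots,n$, and $a_i$ is the preferred spot of $c_i$. $k$-Naples parking rule: car $c_i$ parks in spot $a_i$ if it is free; otherwise it checks one at a time the spots $a_i-1,a_i-2,\ldots,a_i-k$ (only those that are $\ge 1$), parking in the first free one found; if none is free, it proceeds forward and parks in the first free spot $>a_i$, if any; otherwise it fails to park. $PF_{n,k}$, the set of $k$-Naples parking functions of length $n$, is the set of $\alpha\in PP_n$ for which all cars park under this rule. $|\alpha|_i$ is the number of indices $h$ with $a_h=i$. The excess function is $u_\alpha(j)=\sum_{i=j}^n|\alpha|_i-(n-j+1)$ for $j\in[n]$, and $U_\alpha=\{j\in[n] : u_\alpha(j)\ge 1\}$ (note $1\notin U_\alpha$, so $p\ge 2$). A maximal interval $[p,q]\subseteq U_\alpha$ is a nonempty interval of consecutive integers contained in $U_\alpha$ that is maximal under inclusion. For $n\ge 2$, $\alpha\in PP_n$ is complete if $U_\alpha=[2,n]$; a complete $k$-Naples parking function is a complete parking preference that is a $k$-Naples parking function. For $w\in\mathbb Z$ the $w$-shift of a tuple $(b_1,\ldots,b_h)$ is $\tau_w(b_1,\ldots,b_h)=(b_1-w,\ldots,b_h-w)$. For $J=\{j_1<\cdots<j_h\}\subseteq[n]$, the restriction is $\alpha_{|_J}=(a_{j_1},\ldots,a_{j_h})$.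 -}

module Defs where

open import Data.Nat using (ℕ; suc; _+_; _∸_; _≤_; _≤?_; _≟_)
open import Data.Integer as ℤ using (ℤ)
open import Data.Bool using (true; false)
open import Data.List as List using (List; []; _∷_; _++_; applyUpTo; filter; find; fromMaybe)
open import Data.Nat.ListAction using (sum)
open import Data.List.Membership.Propositional using (_∈_)
open import Data.List.Membership.DecPropositional _≟_ using (_∉?_)
import Data.List.Relation.Unary.All as ListAll
open import Data.Maybe using (Maybe; just; Is-just)
open import Data.Vec as Vec using (Vec; []; _∷_; count; toList; lookup)
open import Data.Vec.Relation.Unary.All using (All)
open import Data.Fin.Subset as Subset using (Subset; ∣_∣)
open import Data.Product using (_×_; ∃-syntax)
open import Level using (0ℓ)
open import Relation.Unary using (Pred; _⊆_; _≐_)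

[_⋯_] : ℕ → ℕ → Pred ℕ 0ℓ
[ a ⋯ b ] i = a ≤ i × i ≤ b

range : ℕ → ℕ → List ℕ
range a b = applyUpTo (a +_) (suc b ∸ a)

-- Tuples are vectors of naturals, rather than vectors over Fin n, so that
-- restrictions and shifts (which change n) need no conversions.
IsPP : ∀ {n} → Vec ℕ n → Set
IsPP {n} α = All [ 1 ⋯ n ] α

-- The spots examined by a car with preference a, in order: a itself, then
-- a-1, …, a-k (those that are ≥ 1; a ∸ i is 0 for the others), then a+1, …, n.
probes : (n k a : ℕ) → List ℕ
probes n k a =
  a ∷ filter (1 ≤?_) (List.map (a ∸_) (range 1 k)) ++ range (suc a) n

park : (n k : ℕ) (occupied : List ℕ) (a : ℕ) → Maybe ℕ
park n k occupied a = find (_∉? occupied) (probes n k a)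

-- The spot taken by each car, in order of arrival (nothing if it fails to
-- park; later cars still arrive).  The number of cars need not be n.
outcomesFrom : (n k : ℕ) (occupied : List ℕ) → List ℕ → List (Maybe ℕ)
outcomesFrom n k occupied []       = []
outcomesFrom n k occupied (a ∷ as) =
  let s = park n k occupied a
  in s ∷ outcomesFrom n k (fromMaybe s ++ occupied) as

outcomes : (n k : ℕ) → List ℕ → List (Maybe ℕ)
outcomes n k = outcomesFrom n k []

PF : ∀ {n} → ℕ → Vec ℕ n → Set
PF {n} k α = IsPP α × ListAll.All Is-just (outcomes n k (toList α))

mult : ∀ {n} → Vec ℕ n → ℕ → ℕ
mult α i = count (_≟ i) α

excess : ∀ {n} → Vec ℕ n → ℕ → ℤ
excess {n} α j =
  ℤ.+ sum (List.map (mult α) (range j n)) ℤ.- (ℤ.+ n ℤ.- ℤ.+ j ℤ.+ ℤ.+ 1)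

U : ∀ {n} → Vec ℕ n → Pred ℕ 0ℓ
U {n} α j = [ 1 ⋯ n ] j × ℤ.+ 1 ℤ.≤ excess α j

MaximalInterval : Pred ℕ 0ℓ → (p q : ℕ) → Set
MaximalInterval V p q =
  p ≤ q × [ p ⋯ q ] ⊆ V ×
  (∀ p′ q′ → [ p′ ⋯ q′ ] ⊆ V → [ p ⋯ q ] ⊆ [ p′ ⋯ q′ ] → [ p′ ⋯ q′ ] ⊆ [ p ⋯ q ])

Complete : ∀ {n} → Vec ℕ n → Set
Complete {n} α = 2 ≤ n × IsPP α × U α ≐ [ 2 ⋯ n ]

-- Truncated subtraction: this is the w-shift for 0 ≤ w ≤ all entries, and
-- it is only applied with w = p - 2 to entries that are ≥ p.
τ : ∀ {h} → ℕ → Vec ℕ h → Vec ℕ h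
τ w = Vec.map (_∸ w)

restrict : ∀ {n} (J : Subset n) → Vec ℕ n → Vec ℕ ∣ J ∣
restrict []          []      = []
restrict (true ∷ J)  (a ∷ α) = a ∷ restrict J α
restrict (false ∷ J) (a ∷ α) = restrict J α

size : (p q : ℕ) → ℕ
size p q = suc q ∸ p

PrecedingSpotOccupied : ∀ {n} (k : ℕ) (α : Vec ℕ n) (p : ℕ) → Set
PrecedingSpotOccupied {n} k α p =
  just (p ∸ 1) ∈ outcomes n k (filter (p ≤?_) (toList α))

-- Members p of U α satisfy 2 ≤ p, so p ∸ 2 is p - 2; and |J| ≥ q-p+2 is
-- |J| ≥ |[p,q]| + 1.
HasCompleteRestriction : ∀ {n} (k : ℕ) (α : Vec ℕ n) (p q : ℕ) → Set
HasCompleteRestriction {n} k α p q =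
  ∃[ J ] suc (size p q) ≤ ∣ J ∣
       × (∀ j → j Subset.∈ J → [ p ⋯ p ∸ 2 + ∣ J ∣ ] (lookup α j))
       × PF k (τ (p ∸ 2) (restrict J α))
       × Complete (τ (p ∸ 2) (restrict J α))

{-# OPTIONS --safe #-}
-- Two facts drive everything. Parking is monotone: occupying fewer spots beforehand, or removing cars,
-- leaves a subset of the spots occupied. And a spot x that stays free separates the cars: those landing below
-- (above) x prefer a spot below (above) x, for they would have stopped at x. Maximality of [p,q] gives
-- exactly n-p+2 cars preferring p or more and none preferring p-1. If they occupy p-1, counting the cars
-- below the first free spot shows that they occupy all of [p-1,q]. If α is not a parking function, then
-- the last free spot s has s+1 ∈ U_α, so s lies in some [p-1,q], which is excluded by (i).
-- For (i) ⇒ (ii), let t ≥ q be least such that no car landing in [p-1,t] prefers a spot beyond t, and let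
-- J be the cars landing in [p-1,t]. For q < i ≤ t some car of J crosses i backwards, and none crosses i
-- forwards (a car doing so towards f would make f-1 a smaller choice of t), whence completeness.
-- For (ii) ⇒ (i), as long as p-1 is free the cars of J park as on their own street or find that spot taken,
-- and on their own street they fill the first spot.
module Submission where

open import Defs
open import Data.Nat
open import Data.Nat.Properties
open import Data.Nat.ListAction using (sum)
open import Data.Nat.Tactic.RingSolver using (solve-∀)
open import Data.Bool using (true; false; if_then_else_)
open import Data.Fin using (zero; suc)
open import Data.Fin.Subset as Subset using (Subset; ∣_∣)
open import Data.Integer as ℤ using ()
import Data.Integer.Properties as ℤ
import Data.Integer.Tactic.RingSolver as ℤ
open import Data.List using (List; []; _∷_; _++_; map; filter; find; length; fromMaybe)
open import Data.List.Properties
  using (length-map; length-applyUpTo; length-++; length-filter; filter-all; filter-none; filter-some;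
         filter-accept; filter-reject; filter-≐; map-∘)
open import Data.List.Membership.Propositional using (_∈_; _∉_; lose) renaming (find to find∈)
open import Data.List.Membership.Propositional.Properties
open import Data.List.Membership.DecPropositional _≟_ using (_∈?_; _∉?_)
open import Data.List.Relation.Binary.Subset.Propositional using (_⊆_)
open import Data.List.Relation.Binary.Subset.Propositional.Properties using (⊆-trans)
open import Data.List.Relation.Unary.All as All using (All; []; _∷_)
import Data.List.Relation.Unary.All.Properties as All
open import Data.List.Relation.Unary.AllPairs using (AllPairs; []; _∷_)
import Data.List.Relation.Unary.AllPairs.Properties as AllPairs
open import Data.List.Relation.Unary.Any using (Any; here; there; any?)
open import Data.List.Relation.Unary.Unique.Propositional using (Unique)
import Data.List.Relation.Unary.Unique.Propositional.Properties as Unique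
open import Data.Maybe using (Maybe; just; nothing; Is-just)
open import Data.Maybe.Properties as Maybe using (just-injective)
import Data.Maybe.Relation.Unary.Any as MaybeAny
open import Data.Product using (_×_; _,_; ∃-syntax; proj₁; proj₂; swap)
open import Data.Sum using (_⊎_; inj₁; inj₂; [_,_]′)
open import Data.Unit using (tt)
open import Data.Vec using (Vec; []; _∷_; toList; lookup; here; there)
import Data.Vec.Properties as Vec
import Data.Vec.Relation.Unary.All as VecAll
import Data.Vec.Relation.Unary.All.Properties as VecAll
open import Algebra.Properties.CommutativeSemigroup +-commutativeSemigroup using (x∙yz≈y∙xz)
open import Function using (_∘_; id)
open import Function.Bundles using (_⇔_; mk⇔)
open import Level using (0ℓ)
open import Relation.Binary.Definitions using (tri<; tri≈; tri>)
open import Relation.Binary.PropositionalEquality hiding (J)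
open import Relation.Nullary using (¬_; yes; no; does; contradiction)
open import Relation.Nullary.Decidable using (decidable-stable; ¬?; _×-dec_)
open import Relation.Unary using (Pred; Decidable)
open import Relation.Unary.Properties using (∁?; _∩?_) renaming (U? to universal?)

private variable
  A : Set
  a b x y s s′ n k : ℕ
  O O′ : List ℕ

-- Integer ranges and the pigeonhole principle

∈-range⁺ : a ≤ x → x ≤ b → x ∈ range a b
∈-range⁺ {a} {x} {b} a≤x x≤b = subst (_∈ range a b) (m+[n∸m]≡n a≤x)
  (∈-applyUpTo⁺ (a +_) (∸-monoˡ-< (s≤s x≤b) a≤x))

i<n∸a⇒a+i<n : ∀ a {i n} → i < n ∸ a → a + i < n
i<n∸a⇒a+i<n zero            i< = i<
i<n∸a⇒a+i<n (suc a) {n = suc n} i< = s≤s (i<n∸a⇒a+i<n a i<)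

∈-range⁻ : ∀ a b → x ∈ range a b → a ≤ x × x ≤ b
∈-range⁻ a b x∈ with i , i< , refl ← ∈-applyUpTo⁻ (a +_) x∈ =
  m≤m+n a i , s≤s⁻¹ (i<n∸a⇒a+i<n a i<)

range-unique : ∀ a b → Unique (range a b)
range-unique a b = Unique.applyUpTo⁺₁ (a +_) (suc b ∸ a) λ i<j _ → <⇒≢ (+-monoʳ-< a i<j)

length-range : ∀ a b → length (range a b) ≡ suc b ∸ a
length-range a b = length-applyUpTo (a +_) (suc b ∸ a)

-- Pigeonhole, by cutting the head of `xs` out of `ys`: uniqueness keeps the tail of `xs` inside
-- what remains.
unique-⊆⇒length≤ : {xs ys : List A} → Unique xs → (∀ {x} → x ∈ xs → x ∈ ys) → length xs ≤ length ys
unique-⊆⇒length≤ []          _     = z≤n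
unique-⊆⇒length≤ {xs = x ∷ xs} {ys} (x∉xs ∷ xs!) xs⊆ys
  with as , bs , refl ← ∈-∃++ (xs⊆ys (here refl)) = begin
  suc (length xs)              ≤⟨ s≤s (unique-⊆⇒length≤ xs! xs⊆as++bs) ⟩
  suc (length (as ++ bs))      ≡⟨ cong suc (length-++ as) ⟩
  suc (length as + length bs)  ≡⟨ +-suc (length as) (length bs) ⟨
  length as + suc (length bs)  ≡⟨ length-++ as ⟨
  length (as ++ x ∷ bs)        ∎
  where
  open ≤-Reasoning
  xs⊆as++bs : ∀ {y} → y ∈ xs → y ∈ as ++ bs
  xs⊆as++bs y∈xs with ∈-++⁻ as (xs⊆ys (there y∈xs))
  ... | inj₁ y∈as         = ∈-++⁺ˡ y∈as
  ... | inj₂ (here refl)  = contradiction refl (All.lookup x∉xs y∈xs)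
  ... | inj₂ (there y∈bs) = ∈-++⁺ʳ as y∈bs

length-filter-∁ : ∀ {P : A → Set} (P? : Decidable P) xs →
  length (filter (∁? P?) xs) + length (filter P? xs) ≡ length xs
length-filter-∁ P? [] = refl
length-filter-∁ P? (x ∷ xs) with P? x
... | yes _ = trans (+-suc _ _) (cong suc (length-filter-∁ P? xs))
... | no  _ = cong suc (length-filter-∁ P? xs)

-- The order of the probes

-- x precedes y in the order a, a-1, …, 1, a+1, a+2, … .
Before : (a x y : ℕ) → Set
Before a x y = (x < y × a < y) ⊎ (y < x × x ≤ a)

-- The number k limits only the backward search: a spot x above a satisfies `a ≤ x + k` for every k,
-- so one inequality covers both directions.
Probed : (n k a x : ℕ) → Set
Probed n k a x = [ 1 ⋯ n ] x × a ≤ x + k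

-- The result of `park` described without lists, as the first free probed spot in the order
-- `Before`. Monotonicity and translation are proved in this form and carried back by `park-just⁺`.
Lands : (n k : ℕ) (O : List ℕ) (a s : ℕ) → Set
Lands n k O a s = Probed n k a s × s ∉ O × (∀ x → Probed n k a x → Before a x s → x ∈ O)

Before-irrefl : ¬ Before a x x
Before-irrefl (inj₁ (x<x , _)) = <-irrefl refl x<x
Before-irrefl (inj₂ (x<x , _)) = <-irrefl refl x<x

Before-asym : Before a x y → ¬ Before a y x
Before-asym (inj₁ (x<y , _))   (inj₁ (y<x , _))   = <-asym x<y y<x
Before-asym (inj₁ (_ , a<y))   (inj₂ (_ , y≤a))   = <⇒≱ a<y y≤a
Before-asym (inj₂ (_ , x≤a))   (inj₁ (_ , a<x))   = <⇒≱ a<x x≤a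
Before-asym (inj₂ (y<x , _))   (inj₂ (x<y , _))   = <-asym x<y y<x

Before-connected : ∀ a → x < y → Before a x y ⊎ Before a y x
Before-connected {y = y} a x<y with y ≤? a
... | yes y≤a = inj₂ (inj₂ (x<y , y≤a))
... | no  y≰a = inj₁ (inj₁ (x<y , ≰⇒> y≰a))

-- Of two distinct candidates one comes `Before` the other, and the later one requires the earlier
-- one to be occupied.
Lands-functional : Lands n k O a s → Lands n k O a s′ → s ≡ s′
Lands-functional {a = a} {s} {s′} (ps , s∉O , s-first) (ps′ , s′∉O , s′-first) with <-cmp s s′
... | tri≈ _ s≡s′ _ = s≡s′
... | tri< s<s′ _ _ = [ (λ s≺s′ → contradiction (s′-first s ps s≺s′) s∉O)
                    , (λ s′≺s → contradiction (s-first s′ ps′ s′≺s) s′∉O) ]′ (Before-connected a s<s′)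
... | tri> _ _ s′<s = [ (λ s′≺s → contradiction (s-first s′ ps′ s′≺s) s′∉O)
                    , (λ s≺s′ → contradiction (s′-first s ps s≺s′) s∉O) ]′ (Before-connected a s′<s)

find-just : ∀ {R : ℕ → ℕ → Set} {xs} → AllPairs R xs → find (_∉? O) xs ≡ just s →
  s ∈ xs × s ∉ O × (∀ {x} → x ∈ xs → x ∈ O ⊎ x ≡ s ⊎ R s x)
find-just {O = O} {xs = y ∷ ys} (y≺ys ∷ ≺ys) eq with y ∈? O
find-just (y≺ys ∷ _) refl | no y∉O = here refl , y∉O , λ where
  (here refl)  → inj₂ (inj₁ refl)
  (there x∈ys) → inj₂ (inj₂ (All.lookup y≺ys x∈ys))
... | yes y∈O with s∈ys , s∉O , rest ← find-just ≺ys eq = there s∈ys , s∉O , λ where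
  (here refl)  → inj₁ y∈O
  (there x∈ys) → rest x∈ys

find-nothing : ∀ {xs} → find (_∉? O) xs ≡ nothing → All (_∈ O) xs
find-nothing {xs = []}     _  = []
find-nothing {O = O} {xs = y ∷ ys} eq with y ∈? O
... | yes y∈O = y∈O ∷ find-nothing eq

1≤m∸n⇒n<m : ∀ {m n} → 1 ≤ m ∸ n → n < m
1≤m∸n⇒n<m 1≤m∸n = m∸n≢0⇒n<m (>⇒≢ 1≤m∸n)

backwardProbes : (k a : ℕ) → List ℕ
backwardProbes k a = filter (1 ≤?_) (map (a ∸_) (range 1 k))

∈-backwardProbes⁻ : ∀ k a → x ∈ backwardProbes k a → 1 ≤ x × x < a × a ≤ x + k
∈-backwardProbes⁻ k a x∈
  with x∈map , 1≤x ← ∈-filter⁻ (1 ≤?_) {xs = map (a ∸_) (range 1 k)} x∈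
  with d , d∈ , refl ← ∈-map⁻ (a ∸_) x∈map
  with 1≤d , d≤k ← ∈-range⁻ 1 k d∈ =
  1≤x , ∸-monoʳ-< {o = 0} 1≤d (<⇒≤ (1≤m∸n⇒n<m 1≤x)) ,
  ≤-trans (m≤n+m∸n a d) (≤-trans (≤-reflexive (+-comm d (a ∸ d))) (+-monoʳ-≤ (a ∸ d) d≤k))

∈-probes⁻ : [ 1 ⋯ n ] a → x ∈ probes n k a → Probed n k a x
∈-probes⁻ {n} {a} {x} {k} (1≤a , a≤n) (here refl) = (1≤a , a≤n) , m≤m+n a k
∈-probes⁻ {n} {a} {x} {k} (1≤a , a≤n) (there x∈) with ∈-++⁻ (filter (1 ≤?_) (map (a ∸_) (range 1 k))) x∈
... | inj₁ x∈back with 1≤x , x<a , a≤x+k ← ∈-backwardProbes⁻ k a x∈back =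
  (1≤x , ≤-trans (<⇒≤ x<a) a≤n) , a≤x+k
... | inj₂ x∈fwd with a<x , x≤n ← ∈-range⁻ (suc a) n x∈fwd =
  (≤-trans 1≤a (<⇒≤ a<x) , x≤n) , ≤-trans (<⇒≤ a<x) (m≤m+n x k)

∈-probes⁺ : Probed n k a x → x ∈ probes n k a
∈-probes⁺ {n} {k} {a} {x} ((1≤x , x≤n) , a≤x+k) with <-cmp x a
... | tri≈ _ refl _ = here refl
... | tri> _ _ a<x = there (∈-++⁺ʳ _ (∈-range⁺ a<x x≤n))
... | tri< x<a _ _ = there (∈-++⁺ˡ (∈-filter⁺ (1 ≤?_)
  (subst (_∈ map (a ∸_) (range 1 k)) (m∸[m∸n]≡n (<⇒≤ x<a))
    (∈-map⁺ (a ∸_) (∈-range⁺ (m<n⇒0<n∸m x<a) (m≤n+o⇒m∸n≤o a x a≤x+k)))) 1≤x))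

-- The proviso 1 ≤ y lets the relation hold before the truncated entries a ∸ i ≡ 0 are filtered out.
probes-sorted : ∀ n k a → AllPairs (λ x y → 1 ≤ y → Before a x y) (probes n k a)
probes-sorted n k a =
  All.++⁺ (All.tabulate a≺back) (All.tabulate a≺fwd) ∷
  AllPairs.++⁺ (AllPairs.filter⁺ (1 ≤?_) (AllPairs.map⁺ (AllPairs.applyUpTo⁺₁ (1 +_) k λ i<j _ → back≺back i<j)))
               (AllPairs.applyUpTo⁺₁ _ _ λ {i} {j} i<j _ _ → inj₁ (+-monoʳ-< (suc a) i<j , s≤s (m≤m+n a j)))
               (All.tabulate λ x∈ → All.tabulate λ y∈ → back≺fwd x∈ y∈)
  where
  a≺back : x ∈ backwardProbes k a → 1 ≤ x → Before a a x
  a≺back x∈ _ with _ , x<a , _ ← ∈-backwardProbes⁻ k a x∈ = inj₂ (x<a , ≤-refl)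
  a≺fwd : x ∈ range (suc a) n → 1 ≤ x → Before a a x
  a≺fwd x∈ _ with a<x , _ ← ∈-range⁻ (suc a) n x∈ = inj₁ (a<x , a<x)
  back≺fwd : x ∈ backwardProbes k a → y ∈ range (suc a) n → 1 ≤ y → Before a x y
  back≺fwd x∈ y∈ _ with _ , x<a , _ ← ∈-backwardProbes⁻ k a x∈ | a<y , _ ← ∈-range⁻ (suc a) n y∈ =
    inj₁ (<-trans x<a a<y , a<y)
  back≺back : ∀ {i j} → i < j → 1 ≤ a ∸ suc j → Before a (a ∸ suc i) (a ∸ suc j)
  back≺back {i} {j} i<j 1≤ = inj₂ (∸-monoʳ-< {a} (s≤s i<j) (<⇒≤ (1≤m∸n⇒n<m 1≤)) , m∸n≤m a (suc i))

park-just⁻ : ∀ n k O → [ 1 ⋯ n ] a → park n k O a ≡ just s → Lands n k O a s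
park-just⁻ {a} {s} n k O a∈ eq
  with s∈ , s∉O , rest ← find-just (probes-sorted n k a) eq =
  ∈-probes⁻ a∈ s∈ , s∉O , first
  where
  first : ∀ x → Probed n k a x → Before a x s → x ∈ O
  first x px x≺s with rest (∈-probes⁺ px)
  ... | inj₁ x∈O          = x∈O
  ... | inj₂ (inj₁ refl)  = contradiction x≺s Before-irrefl
  ... | inj₂ (inj₂ s≺x)   = contradiction (s≺x (proj₁ (proj₁ px))) (Before-asym x≺s)

park-nothing⁻ : ∀ n k O → park n k O a ≡ nothing → Probed n k a x → x ∈ O
park-nothing⁻ n k O eq px = All.lookup (find-nothing eq) (∈-probes⁺ px)

park-just⁺ : ∀ n k O → [ 1 ⋯ n ] a → Lands n k O a s → park n k O a ≡ just s
park-just⁺ {a} n k O a∈ lands@(ps , s∉O , _) with park n k O a in eq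
... | nothing = contradiction (park-nothing⁻ n k O eq ps) s∉O
... | just t  = cong just (Lands-functional (park-just⁻ n k O a∈ eq) lands)

-- Filters and lists of outcomes

filter-filter : ∀ {P Q R : A → Set} (P? : Decidable P) (Q? : Decidable Q) (R? : Decidable R) →
  (∀ {x} → P x → Q x → R x) → (∀ {x} → R x → P x × Q x) →
  ∀ xs → filter P? (filter Q? xs) ≡ filter R? xs
filter-filter P? Q? R? ⇒ ⇐ [] = refl
filter-filter P? Q? R? ⇒ ⇐ (x ∷ xs) with Q? x | R? x
... | yes qx | yes rx with P? x
...   | yes _  = cong (x ∷_) (filter-filter P? Q? R? ⇒ ⇐ xs)
...   | no ¬px = contradiction (proj₁ (⇐ rx)) ¬px
filter-filter P? Q? R? ⇒ ⇐ (x ∷ xs) | yes qx | no ¬rx with P? x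
...   | yes px = contradiction (⇒ px qx) ¬rx
...   | no _   = filter-filter P? Q? R? ⇒ ⇐ xs
filter-filter P? Q? R? ⇒ ⇐ (x ∷ xs) | no ¬qx | yes rx = contradiction (proj₂ (⇐ rx)) ¬qx
filter-filter P? Q? R? ⇒ ⇐ (x ∷ xs) | no _   | no _   = filter-filter P? Q? R? ⇒ ⇐ xs

filter-map : ∀ {B : Set} {P : B → Set} (P? : Decidable P) (f : A → B) xs →
  filter P? (map f xs) ≡ map f (filter (P? ∘ f) xs)
filter-map P? f []       = refl
filter-map P? f (x ∷ xs) with P? (f x)
... | yes _ = cong (f x ∷_) (filter-map P? f xs)
... | no  _ = filter-map P? f xs

-- For preferences at most n this is the sum in `excess`; see `sum-mult`.
countFrom : List ℕ → ℕ → ℕ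
countFrom as j = length (filter (j ≤?_) as)

AllPairs-lookup : ∀ {R : A → A → Set} {xs x y} → AllPairs R xs → x ∈ xs → y ∈ xs → x ≡ y ⊎ R x y ⊎ R y x
AllPairs-lookup (_  ∷ _)  (here refl) (here refl) = inj₁ refl
AllPairs-lookup (px ∷ _)  (here refl) (there y∈)  = inj₂ (inj₁ (All.lookup px y∈))
AllPairs-lookup (py ∷ _)  (there x∈)  (here refl) = inj₂ (inj₂ (All.lookup py x∈))
AllPairs-lookup (_ ∷ pxs) (there x∈)  (there y∈)  = AllPairs-lookup pxs x∈ y∈

-- Inductions along a run keep the alternative that a spot is occupied at the start or taken later.
-- The spot taken by the first car passes from one side to the other.
just∈-∷⁺ : ∀ {m : Maybe ℕ} {ms} → x ∈ fromMaybe m ++ O ⊎ just x ∈ ms → x ∈ O ⊎ just x ∈ m ∷ ms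
just∈-∷⁺ {m = just _}  (inj₁ (here refl)) = inj₂ (here refl)
just∈-∷⁺ {m = just _}  (inj₁ (there x∈O)) = inj₁ x∈O
just∈-∷⁺ {m = nothing} (inj₁ x∈O)         = inj₁ x∈O
just∈-∷⁺               (inj₂ x∈ms)        = inj₂ (there x∈ms)

just∈-∷⁻ : ∀ {m : Maybe ℕ} {ms} → just x ∈ m ∷ ms → x ∈ fromMaybe m ++ O ⊎ just x ∈ ms
just∈-∷⁻ (here refl) = inj₁ (here refl)
just∈-∷⁻ (there x∈)  = inj₂ x∈

-- Runs of the parking process

-- A car of a run: the spots occupied on its arrival, and its preference.
Entry : Set
Entry = List ℕ × ℕ

occ : Entry → List ℕ
occ = proj₁

pref : Entry → ℕ
pref = proj₂

module Run (n k : ℕ) where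

  spot : Entry → Maybe ℕ
  spot (O , a) = park n k O a

  after : Entry → List ℕ
  after e = fromMaybe (spot e) ++ occ e

  -- The outcomes forget what each car found on arrival; the entries keep it, so that the spots
  -- passed by a car can be recovered from `Lands`.
  log : List ℕ → List ℕ → List Entry
  log O []       = []
  log O (a ∷ as) = (O , a) ∷ log (after (O , a)) as

  outcomes-log : ∀ O as → outcomesFrom n k O as ≡ map spot (log O as)
  outcomes-log O []       = refl
  outcomes-log O (a ∷ as) = cong (park n k O a ∷_) (outcomes-log _ as)

  prefs-log : ∀ O as → map pref (log O as) ≡ as
  prefs-log O []       = refl
  prefs-log O (a ∷ as) = cong (a ∷_) (prefs-log _ as)

  after-⊇ : ∀ e → occ e ⊆ after e
  after-⊇ e = ∈-++⁺ʳ (fromMaybe (spot e))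

  ∈-after : ∀ e → spot e ≡ just s → s ∈ after e
  ∈-after e eq rewrite eq = here refl

  ∈-after⁻ : ∀ {e} → x ∈ after e → spot e ≡ just x ⊎ x ∈ occ e
  ∈-after⁻ {e = e} x∈ with spot e
  ... | nothing = inj₂ x∈
  ∈-after⁻ {e = e} (here refl) | just _ = inj₁ refl
  ∈-after⁻ {e = e} (there x∈)  | just _ = inj₂ x∈

  log-⊇ : ∀ O as → All (λ e → O ⊆ occ e) (log O as)
  log-⊇ O []       = []
  log-⊇ O (a ∷ as) = id ∷ All.map (⊆-trans (after-⊇ (O , a))) (log-⊇ _ as)

  -- Order of arrival, expressed without indices: the occupied spots only grow along the run.
  log-ordered : ∀ O as → AllPairs (λ e f → after e ⊆ occ f) (log O as)
  log-ordered O []       = []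
  log-ordered O (a ∷ as) = log-⊇ _ as ∷ log-ordered _ as

  occ-landed : ∀ O as {e} → e ∈ log O as → x ∈ occ e → x ∈ O ⊎ just x ∈ outcomesFrom n k O as
  occ-landed O (a ∷ as) (here refl) x∈ = inj₁ x∈
  occ-landed O (a ∷ as) (there e∈)  x∈ = just∈-∷⁺ (occ-landed _ as e∈ x∈)

  -- If s is free in `O` too, it is still the first free probed spot, since the spots before it are
  -- occupied in `O′` and hence in `O`.
  park-mono : [ 1 ⋯ n ] a → O′ ⊆ O → park n k O′ a ≡ just s → s ∈ O ⊎ park n k O a ≡ just s
  park-mono {O′ = O′} {O = O} {s = s} a∈ O′⊆O eq with s ∈? O
  ... | yes s∈O = inj₁ s∈O
  ... | no  s∉O with ps , _ , first ← park-just⁻ n k O′ a∈ eq =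
    inj₂ (park-just⁺ n k O a∈ (ps , s∉O , λ x px x≺s → O′⊆O (first x px x≺s)))

  after-mono : [ 1 ⋯ n ] a → O′ ⊆ O → after (O′ , a) ⊆ after (O , a)
  after-mono {a} {O′} {O} a∈ O′⊆O x∈ with park n k O′ a in eq
  ... | nothing = after-⊇ (O , a) (O′⊆O x∈)
  after-mono {a} {O′} {O} a∈ O′⊆O (there x∈)  | just s = after-⊇ (O , a) (O′⊆O x∈)
  after-mono {a} {O′} {O} a∈ O′⊆O (here refl) | just s with park-mono a∈ O′⊆O eq
  ... | inj₁ s∈O = after-⊇ (O , a) s∈O
  ... | inj₂ eq′ = ∈-after (O , a) eq′

  park-is-just-mono : [ 1 ⋯ n ] a → O′ ⊆ O → Is-just (park n k O a) → Is-just (park n k O′ a)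
  park-is-just-mono {a} {O′} {O} a∈ O′⊆O j with park n k O a in eq | park n k O′ a in eq′
  ... | just s | just _  = MaybeAny.just tt
  ... | just s | nothing with ps , s∉O , _ ← park-just⁻ n k O a∈ eq =
    contradiction (O′⊆O (park-nothing⁻ n k O′ eq′ ps)) s∉O

  module _ {P : ℕ → Set} (P? : Decidable P) where

    -- The run with and the run without the removed cars advance together. A removed car only
    -- enlarges the larger occupied list, and a common car preserves the inclusion by `after-mono`.
    outcomes-mono : ∀ as → All [ 1 ⋯ n ] as → O′ ⊆ O →
      just x ∈ outcomesFrom n k O′ (filter P? as) → x ∈ O ⊎ just x ∈ outcomesFrom n k O as
    outcomes-mono (a ∷ as) (a∈ ∷ as∈) O′⊆O x∈ with P? a
    ... | no _ = just∈-∷⁺ (outcomes-mono as as∈ (⊆-trans O′⊆O (after-⊇ _)) x∈)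
    ... | yes _ with just∈-∷⁻ x∈
    ...   | inj₁ x∈after = just∈-∷⁺ (inj₁ (after-mono a∈ O′⊆O x∈after))
    ...   | inj₂ x∈rest  = just∈-∷⁺ (outcomes-mono as as∈ (after-mono a∈ O′⊆O) x∈rest)

    all-park-mono : ∀ as → All [ 1 ⋯ n ] as → O′ ⊆ O →
      All Is-just (outcomesFrom n k O as) → All Is-just (outcomesFrom n k O′ (filter P? as))
    all-park-mono []       []         O′⊆O []       = []
    all-park-mono (a ∷ as) (a∈ ∷ as∈) O′⊆O (j ∷ js) with P? a
    ... | no _  = all-park-mono as as∈ (⊆-trans O′⊆O (after-⊇ _)) js
    ... | yes _ = park-is-just-mono a∈ O′⊆O j ∷ all-park-mono as as∈ (after-mono a∈ O′⊆O) js

  LandsIn : (x y : ℕ) → Entry → Set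
  LandsIn x y e = MaybeAny.Any [ x ⋯ y ] (spot e)

  LandsIn? : ∀ x y → Decidable (LandsIn x y)
  LandsIn? x y e = MaybeAny.dec (λ s → x ≤? s ×-dec s ≤? y) (spot e)

  landsIn⁺ : ∀ {e} → spot e ≡ just s → x ≤ s → s ≤ y → LandsIn x y e
  landsIn⁺ eq x≤s s≤y = subst (MaybeAny.Any _) (sym eq) (MaybeAny.just (x≤s , s≤y))

  landsIn⁻ : ∀ e → LandsIn x y e → ∃[ s ] spot e ≡ just s × [ x ⋯ y ] s
  landsIn⁻ e b with spot e
  landsIn⁻ e (MaybeAny.just s∈) | just s = s , refl , s∈

  -- The spot of an earlier car is occupied when a later one arrives, and the later one lands on a
  -- free spot.
  distinct-spots : ∀ {es} → AllPairs (λ e f → after e ⊆ occ f) es →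
    All (λ e → [ 1 ⋯ n ] (pref e) × ∃[ s ] spot e ≡ just s) es → Unique (map spot es)
  distinct-spots []       []                     = []
  distinct-spots (e≺es ∷ ≺es) ((_ , s , eq) ∷ lands) =
    All.map⁺ (All.zipWith (λ {f} (after⊆ , f∈ , _) eq′ →
      proj₁ (proj₂ (park-just⁻ n k (occ f) f∈ (trans (sym eq′) eq))) (after⊆ (∈-after _ eq))) (e≺es , lands))
    ∷ distinct-spots ≺es lands

  -- Free spots and the counting of landings on one street

  module Street (as : List ℕ) (as∈ : All [ 1 ⋯ n ] as) where

    entries : List Entry
    entries = log [] as

    Occupied : ℕ → Set
    Occupied x = just x ∈ outcomes n k as

    pref-bounds : ∀ {e} → e ∈ entries → [ 1 ⋯ n ] (pref e)
    pref-bounds e∈ = All.lookup as∈ (subst (_ ∈_) (prefs-log [] as) (∈-map⁺ pref e∈))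

    occupied⁺ : ∀ {e} → e ∈ entries → spot e ≡ just x → Occupied x
    occupied⁺ e∈ eq = subst₂ _∈_ eq (sym (outcomes-log [] as)) (∈-map⁺ spot e∈)

    occupied⁻ : Occupied x → ∃[ e ] e ∈ entries × spot e ≡ just x
    occupied⁻ ox with e , e∈ , eq ← ∈-map⁻ spot (subst (_ ∈_) (outcomes-log [] as) ox) = e , e∈ , sym eq

    occ⇒occupied : ∀ {e} → e ∈ entries → x ∈ occ e → Occupied x
    occ⇒occupied e∈ x∈ with inj₂ ox ← occ-landed [] as e∈ x∈ = ox

    prefers≥? : ∀ i → Decidable (λ e → i ≤ pref e)
    prefers≥? i e = i ≤? pref e

    length-prefers≥ : ∀ i → length (filter (prefers≥? i) entries) ≡ countFrom as i
    length-prefers≥ i = begin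
      length (filter (prefers≥? i) entries)            ≡⟨ length-map pref (filter (prefers≥? i) entries) ⟨
      length (map pref (filter (prefers≥? i) entries)) ≡⟨ cong length (filter-map (i ≤?_) pref entries) ⟨
      countFrom (map pref entries) i                   ≡⟨ cong (λ bs → countFrom bs i) (prefs-log [] as) ⟩
      countFrom as i                                   ∎
      where open ≡-Reasoning

    Occupied? : Decidable Occupied
    Occupied? x = any? (Maybe.≡-dec _≟_ (just x)) (outcomes n k as)

    parked : All Is-just (outcomes n k as) → ∀ {e} → e ∈ entries → ∃[ s ] spot e ≡ just s
    parked parks {e} e∈ with spot e | All.lookup parks (subst (spot e ∈_) (sym (outcomes-log [] as)) (∈-map⁺ spot e∈))
    ... | just s | _ = s , refl

    lands : ∀ {e} → e ∈ entries → spot e ≡ just s → Lands n k (occ e) (pref e) s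
    lands {e = e} e∈ = park-just⁻ n k (occ e) (pref-bounds e∈)

    passed⇒occupied : ∀ {e} → e ∈ entries → spot e ≡ just s →
      Probed n k (pref e) x → Before (pref e) x s → Occupied x
    passed⇒occupied e∈ eq px x≺s with _ , _ , first ← lands e∈ eq = occ⇒occupied e∈ (first _ px x≺s)

    backward-passes : ∀ {e} → e ∈ entries → spot e ≡ just s → s < x → x ≤ pref e →
      Probed n k (pref e) x × Before (pref e) x s
    backward-passes {s} {x} e∈ eq s<x x≤a with ((1≤s , _) , a≤s+k) , _ ← lands e∈ eq =
      ((≤-trans 1≤s (<⇒≤ s<x) , ≤-trans x≤a (proj₂ (pref-bounds e∈))) , ≤-trans a≤s+k (+-monoˡ-≤ k (<⇒≤ s<x))) ,
      inj₂ (s<x , x≤a)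

    forward-passes : ∀ {e} → e ∈ entries → spot e ≡ just s → 1 ≤ x → x < s → pref e < s → pref e ≤ x + k →
      Probed n k (pref e) x × Before (pref e) x s
    forward-passes e∈ eq 1≤x x<s a<s a≤x+k with ((_ , s≤n) , _) , _ ← lands e∈ eq =
      ((1≤x , ≤-trans (<⇒≤ x<s) s≤n) , a≤x+k) , inj₁ (x<s , a<s)

    free-below : ∀ {e} → ¬ Occupied x → e ∈ entries → spot e ≡ just s → s < x → pref e < x
    free-below {x} {s} {e} ¬ox e∈ eq s<x with x ≤? pref e
    ... | no  x≰a = ≰⇒> x≰a
    ... | yes x≤a with px , x≺s ← backward-passes e∈ eq s<x x≤a = contradiction (passed⇒occupied e∈ eq px x≺s) ¬ox

    free-above : ∀ {e} → ¬ Occupied x → 1 ≤ x → e ∈ entries → spot e ≡ just s → x < s → x < pref e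
    free-above {x} {s} {e} ¬ox 1≤x e∈ eq x<s with pref e ≤? x
    ... | no  a≰x = ≰⇒> a≰x
    ... | yes a≤x with px , x≺s ← forward-passes e∈ eq 1≤x x<s (≤-<-trans a≤x x<s) (≤-trans a≤x (m≤m+n x k)) =
      contradiction (passed⇒occupied e∈ eq px x≺s) ¬ox

    -- A failing car finds every spot within its reach taken, so a spot that stays free must lie
    -- more than k below its preference.
    free-fail : ∀ {e} → ¬ Occupied x → [ 1 ⋯ n ] x → e ∈ entries → spot e ≡ nothing → x + k < pref e
    free-fail {e = e} ¬ox x∈ e∈ eq = ≰⇒> λ a≤x+k → ¬ox (occ⇒occupied e∈ (park-nothing⁻ n k (occ e) eq (x∈ , a≤x+k)))

    module _ {Q : Entry → Set} (Q? : Decidable Q) where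

      -- This bound and the next two compare the outcomes of the cars in `Q` with the range from x
      -- to y by pigeonhole. Adding x to the count avoids truncated subtraction in their statements.
      landings-≤ : x ≤ suc y → (∀ {e} → e ∈ entries → Q e → ∃[ s ] spot e ≡ just s × [ x ⋯ y ] s) →
        length (filter Q? entries) + x ≤ suc y
      landings-≤ {x} {y} x≤ land = m≤o∸n⇒m+n≤o _ x≤ (begin
        length (filter Q? entries)             ≡⟨ length-map spot (filter Q? entries) ⟨
        length (map spot (filter Q? entries))  ≤⟨ unique-⊆⇒length≤ unique ⊆range ⟩
        length (map just (range x y))          ≡⟨ length-map just (range x y) ⟩
        length (range x y)                     ≡⟨ length-range x y ⟩
        suc y ∸ x                              ∎)
        where
        open ≤-Reasoning
        unique : Unique (map spot (filter Q? entries))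
        unique = distinct-spots (AllPairs.filter⁺ Q? (log-ordered [] as)) (All.tabulate λ e∈ →
          let e∈ , q = ∈-filter⁻ Q? e∈ ; s , eq , _ = land e∈ q in pref-bounds e∈ , s , eq)
        ⊆range : ∀ {m} → m ∈ map spot (filter Q? entries) → m ∈ map just (range x y)
        ⊆range m∈ with e , e∈ , refl ← ∈-map⁻ spot m∈
                  with e∈ , q ← ∈-filter⁻ Q? e∈
                  with s , eq , x≤s , s≤y ← land e∈ q =
          subst (_∈ map just (range x y)) (sym eq) (∈-map⁺ just (∈-range⁺ x≤s s≤y))

      just-range⊆ : (∀ s → x ≤ s → s ≤ y → ∃[ e ] e ∈ entries × Q e × spot e ≡ just s) →
        ∀ {m} → m ∈ map just (range x y) → m ∈ map spot (filter Q? entries)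
      just-range⊆ {x} {y} cover m∈ with s , s∈ , refl ← ∈-map⁻ just m∈
                                   with x≤s , s≤y ← ∈-range⁻ x y s∈
                                   with e , e∈ , q , eq ← cover s x≤s s≤y =
        subst (_∈ map spot (filter Q? entries)) eq (∈-map⁺ spot (∈-filter⁺ Q? e∈ q))

      landings-≥ : (∀ s → x ≤ s → s ≤ y → ∃[ e ] e ∈ entries × Q e × spot e ≡ just s) →
        suc y ≤ length (filter Q? entries) + x
      landings-≥ {x} {y} cover = subst (suc y ≤_) (+-comm x _) (≤-trans (m≤n+m∸n (suc y) x) (+-monoʳ-≤ x (begin
        suc y ∸ x                              ≡⟨ length-range x y ⟨
        length (range x y)                     ≡⟨ length-map just (range x y) ⟨
        length (map just (range x y))          ≤⟨ unique-⊆⇒length≤ (Unique.map⁺ just-injective (range-unique x y)) (just-range⊆ cover) ⟩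
        length (map spot (filter Q? entries))  ≡⟨ length-map spot (filter Q? entries) ⟩
        length (filter Q? entries)             ∎)))
        where open ≤-Reasoning

      -- The additional car may have failed: its outcome, possibly `nothing`, is one more element
      -- besides the spots of the range.
      landings-> : ∀ {e} → (∀ s → x ≤ s → s ≤ y → ∃[ e ] e ∈ entries × Q e × spot e ≡ just s) →
        e ∈ entries → Q e → (∀ {s} → spot e ≡ just s → ¬ [ x ⋯ y ] s) →
        2 + y ≤ length (filter Q? entries) + x
      landings-> {x} {y} {e} cover e∈ q outside = subst (2 + y ≤_) (+-comm x _)
        (≤-trans (≤-trans (s≤s (m≤n+m∸n (suc y) x)) (≤-reflexive (sym (+-suc x _)))) (+-monoʳ-≤ x (begin
        suc (suc y ∸ x)                        ≡⟨ cong suc (length-range x y) ⟨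
        suc (length (range x y))               ≡⟨ cong suc (length-map just (range x y)) ⟨
        length (spot e ∷ map just (range x y)) ≤⟨ unique-⊆⇒length≤ (fresh ∷ Unique.map⁺ just-injective (range-unique x y)) ⊆spots ⟩
        length (map spot (filter Q? entries))  ≡⟨ length-map spot (filter Q? entries) ⟩
        length (filter Q? entries)             ∎)))
        where
        open ≤-Reasoning
        fresh : All (spot e ≢_) (map just (range x y))
        fresh = All.map⁺ (All.tabulate λ s∈ eq → outside eq (∈-range⁻ x y s∈))
        ⊆spots : ∀ {m} → m ∈ spot e ∷ map just (range x y) → m ∈ map spot (filter Q? entries)
        ⊆spots (here refl) = ∈-map⁺ spot (∈-filter⁺ Q? e∈ q)
        ⊆spots (there m∈)  = just-range⊆ cover m∈

    -- Otherwise n parked cars would have to share the n-1 spots from 2 to n.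
    all-park⇒first-occupied : length as ≡ n → 1 ≤ n → All Is-just (outcomes n k as) → Occupied 1
    all-park⇒first-occupied len 1≤n parks = decidable-stable (Occupied? 1) λ free →
      1+n≰n (subst (_≤ suc n) (trans (cong (_+ 2) length-entries) (+-comm n 2))
        (landings-≤ universal? {x = 2} {y = n} (s≤s 1≤n) (λ e∈ _ → land free e∈)))
      where
      length-entries : length (filter universal? entries) ≡ n
      length-entries = trans (cong length (filter-all universal? {xs = entries} (All.tabulate λ _ → tt)))
        (trans (sym (length-map pref entries)) (trans (cong length (prefs-log [] as)) len))
      land : ¬ Occupied 1 → ∀ {e} → e ∈ entries → ∃[ s ] spot e ≡ just s × [ 2 ⋯ n ] s
      land free {e} e∈ with s , eq ← parked parks e∈ with ((1≤s , s≤n) , _) , _ ← lands e∈ eq =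
        s , eq , ≤∧≢⇒< 1≤s (λ { refl → free (occupied⁺ e∈ eq) }) , s≤n

-- The cars preferring p or more, and the block of spots [p-1,t]

least : ∀ {P : ℕ → Set} (P? : Decidable P) {q n} → q ≤ n → P n →
  ∃[ t ] q ≤ t × t ≤ n × P t × (∀ {i} → q ≤ i → i < t → ¬ P i)
least {P} P? {q} {n} q≤n Pn = search (n ∸ q) q (m∸n+n≡m q≤n)
  where
  search : ∀ d q → d + q ≡ n → ∃[ t ] q ≤ t × t ≤ n × P t × (∀ {i} → q ≤ i → i < t → ¬ P i)
  search zero    q refl = q , ≤-refl , ≤-refl , Pn , λ q≤i i<q _ → <⇒≱ i<q q≤i
  search (suc d) q eq with P? q
  ... | yes Pq = q , ≤-refl , subst (q ≤_) eq (m≤n+m q (suc d)) , Pq , λ q≤i i<q _ → <⇒≱ i<q q≤i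
  ... | no ¬Pq with t , q<t , t≤n , Pt , min ← search d (suc q) (trans (+-suc d q) eq) =
    t , <⇒≤ q<t , t≤n , Pt , min′
    where
    min′ : ∀ {i} → q ≤ i → i < t → ¬ P i
    min′ q≤i i<t with m≤n⇒m<n∨m≡n q≤i
    ... | inj₁ q<i  = min q<i i<t
    ... | inj₂ refl = ¬Pq

length-filter-filter : ∀ {P Q : A → Set} (P? : Decidable P) (Q? : Decidable Q) xs →
  length (filter P? (filter Q? xs)) ≤ length (filter P? xs)
length-filter-filter P? Q? xs = begin
  length (filter P? (filter Q? xs))  ≡⟨ cong length (filter-filter P? Q? (Q? ∩? P?) (λ p q → q , p) swap xs) ⟩
  length (filter (Q? ∩? P?) xs)      ≡⟨ cong length (filter-filter Q? P? (Q? ∩? P?) _,_ id xs) ⟨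
  length (filter Q? (filter P? xs))  ≤⟨ length-filter Q? (filter P? xs) ⟩
  length (filter P? xs)              ∎
  where open ≤-Reasoning

-- The interval is [p,q] with p = w + 2, and as lists the preferences that are at least p.
module Block (n k w q : ℕ) (as : List ℕ) (as∈ : All [ 1 ⋯ n ] as)
  (w+2≤as : All (2 + w ≤_) as) (w+2≤q : 2 + w ≤ q) (q≤n : q ≤ n)
  (total : length as + (2 + w) ≡ 2 + n)
  (heavy : ∀ {i} → [ 2 + w ⋯ q ] i → 2 + n ≤ countFrom as i + i)
  (light : countFrom as (suc q) + q ≤ n)
  where

  open Run n k
  open Street as as∈

  w+1≤q : suc w ≤ q
  w+1≤q = <⇒≤ w+2≤q

  countBelow : ℕ → ℕ
  countBelow i = length (filter (∁? (prefers≥? i)) entries)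

  total-split : ∀ i → countBelow i + countFrom as i + (2 + w) ≡ 2 + n
  total-split i = begin
    countBelow i + countFrom as i + (2 + w)
      ≡⟨ cong (λ m → countBelow i + m + (2 + w)) (length-prefers≥ i) ⟨
    countBelow i + length (filter (prefers≥? i) entries) + (2 + w)
      ≡⟨ cong (_+ (2 + w)) (length-filter-∁ (prefers≥? i) entries) ⟩
    length entries + (2 + w)
      ≡⟨ cong (_+ (2 + w)) (length-map pref entries) ⟨
    length (map pref entries) + (2 + w)
      ≡⟨ cong (λ bs → length bs + (2 + w)) (prefs-log [] as) ⟩
    length as + (2 + w)
      ≡⟨ total ⟩
    2 + n ∎
    where open ≡-Reasoning

  pref≥ : ∀ {e} → e ∈ entries → 2 + w ≤ pref e
  pref≥ e∈ = All.lookup w+2≤as (subst (_ ∈_) (prefs-log [] as) (∈-map⁺ pref e∈))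

  free⇒lands-above : ¬ Occupied (suc w) → ∀ {e} → e ∈ entries → spot e ≡ just s → 2 + w ≤ s
  free⇒lands-above {s} free e∈ eq with <-cmp s (suc w)
  ... | tri< s<w+1 _ _ = contradiction (<⇒≤ (free-below free e∈ eq s<w+1)) (<⇒≱ (pref≥ e∈))
  ... | tri≈ _ refl _  = contradiction (occupied⁺ e∈ eq) free
  ... | tri> _ _ w+1<s = w+1<s

  -- With p-1 free, all cars would land on the n-p+1 spots from p to n, but `heavy` at p provides
  -- n-p+2 cars.
  all-park⇒occupied : All Is-just (outcomes n k as) → Occupied (suc w)
  all-park⇒occupied parks = decidable-stable (Occupied? (suc w)) λ free →
    <⇒≱ (heavy (≤-refl , w+2≤q)) (subst (λ c → c + (2 + w) ≤ suc n) (length-prefers≥ (2 + w))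
      (landings-≤ (prefers≥? (2 + w)) (≤-trans w+2≤q (m≤n⇒m≤1+n q≤n)) (λ e∈ _ → land free e∈)))
    where
    land : ¬ Occupied (suc w) → ∀ {e} → e ∈ entries → ∃[ s ] spot e ≡ just s × [ 2 + w ⋯ n ] s
    land free e∈ with s , eq ← parked parks e∈ = s , eq , free⇒lands-above free e∈ eq , proj₂ (proj₁ (proj₁ (lands e∈ eq)))

  -- Suppose that p-1 stays free. It is within reach of every car preferring at most q, so such a
  -- car neither fails nor drives forward past q, and it lands in [p,q]. By `total` and `light`
  -- there are at least q-p+2 such cars for q-p+1 spots.
  short⇒occupied : q ≤ suc w + k → Occupied (suc w)
  short⇒occupied q≤ = decidable-stable (Occupied? (suc w)) λ free →
    arith (countBelow (suc q)) (countFrom as (suc q)) (total-split (suc q)) light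
      (landings-≤ (∁? (prefers≥? (suc q))) (m≤n⇒m≤1+n w+2≤q) (λ e∈ q≮a → land free e∈ (s≤s⁻¹ (≰⇒> q≮a))))
    where
    arith : ∀ N M → N + M + (2 + w) ≡ 2 + n → M + q ≤ n → ¬ N + (2 + w) ≤ suc q
    arith N M eq M+q≤n N≤ = <-irrefl eq (s≤s (begin
      N + M + (2 + w)    ≡⟨ regroup N M (2 + w) ⟩
      M + (N + (2 + w))  ≤⟨ +-monoʳ-≤ M N≤ ⟩
      M + suc q          ≡⟨ +-suc M q ⟩
      suc (M + q)        ≤⟨ s≤s M+q≤n ⟩
      suc n              ∎))
      where
      open ≤-Reasoning
      regroup : ∀ a b c → a + b + c ≡ b + (a + c)
      regroup = solve-∀
    land : ¬ Occupied (suc w) → ∀ {e} → e ∈ entries → pref e ≤ q → ∃[ s ] spot e ≡ just s × [ 2 + w ⋯ q ] s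
    land free {e} e∈ a≤q with spot e in eq
    ... | nothing = contradiction (≤-trans a≤q q≤) (<⇒≱ (free-fail free (s≤s z≤n , ≤-trans w+1≤q q≤n) e∈ eq))
    ... | just s  = s , refl , w+2≤s , s≤q
      where
      w+2≤s : 2 + w ≤ s
      w+2≤s = free⇒lands-above free e∈ eq
      s≤q : s ≤ q
      s≤q with s ≤? q
      ... | yes s≤q = s≤q
      ... | no  s≰q with p , b ← forward-passes e∈ eq (s≤s z≤n) w+2≤s (≤-<-trans a≤q (≰⇒> s≰q)) (≤-trans a≤q q≤) =
        contradiction (passed⇒occupied e∈ eq p b) free

  module _ (occupied-w+1 : Occupied (suc w)) where

    -- Induction on x. If x+1 were free while [p-1,x] is full, the x-p+2 cars landing there would
    -- prefer at most x. Only n-x cars at most would prefer x+1 or more, against `heavy`.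
    occupied-up-to : ∀ x → x ≤ q → ∀ {y} → [ suc w ⋯ x ] y → Occupied y
    occupied-up-to zero _ (w+1≤y , y≤0) = contradiction (≤-trans w+1≤y y≤0) λ ()
    occupied-up-to (suc x) 1+x≤q {y} (w+1≤y , y≤1+x) with m≤n⇒m<n∨m≡n y≤1+x | m≤n⇒m<n∨m≡n w+1≤y
    ... | inj₁ y<1+x | _         = occupied-up-to x (<⇒≤ 1+x≤q) (w+1≤y , s≤s⁻¹ y<1+x)
    ... | inj₂ refl  | inj₂ refl = occupied-w+1
    ... | inj₂ refl  | inj₁ w+1<1+x = decidable-stable (Occupied? (suc x)) λ free →
      arith (countBelow (suc x)) (countFrom as (suc x)) (total-split (suc x)) (heavy (w+1<1+x , 1+x≤q))
        (landings-≥ (∁? (prefers≥? (suc x))) λ s w+1≤s s≤x →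
          let e , e∈ , eq = occupied⁻ (occupied-up-to x (<⇒≤ 1+x≤q) (w+1≤s , s≤x))
          in e , e∈ , <⇒≱ (free-below free e∈ eq (s≤s s≤x)) , eq)
      where
      arith : ∀ N M → N + M + (2 + w) ≡ 2 + n → 2 + n ≤ M + suc x → ¬ suc x ≤ N + suc w
      arith N M eq 2+n≤ ≤N = <-irrefl refl (begin
        3 + n                     ≤⟨ s≤s 2+n≤ ⟩
        suc (M + suc x)           ≤⟨ s≤s (+-monoʳ-≤ M ≤N) ⟩
        suc (M + (N + suc w))     ≡⟨ regroup M N w ⟩
        N + M + (2 + w)           ≡⟨ eq ⟩
        2 + n                     ∎)
        where
        open ≤-Reasoning
        regroup : ∀ a b c → suc (a + (b + suc c)) ≡ b + a + (2 + c)
        regroup = solve-∀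

    interval-occupied : ∀ {x} → [ suc w ⋯ q ] x → Occupied x
    interval-occupied (w+1≤x , x≤q) = occupied-up-to _ x≤q (w+1≤x , ≤-refl)

    InBlock : ℕ → Entry → Set
    InBlock = LandsIn (suc w)

    InBlock? : ∀ t → Decidable (InBlock t)
    InBlock? = LandsIn? (suc w)

    Crossed : ℕ → Set
    Crossed t = Any (λ e → InBlock t e × t < pref e) entries

    Crossed? : Decidable Crossed
    Crossed? t = any? (λ e → InBlock? t e ×-dec t <? pref e) entries

    -- The search ends because no preference exceeds n, so that n is not crossed. Minimality is a
    -- double negation since the property searched for is `¬ Crossed`; `crosser` removes it by
    -- decidability.
    cut : ∃[ t ] q ≤ t × t ≤ n × ¬ Crossed t × (∀ {i} → q ≤ i → i < t → ¬ ¬ Crossed i)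
    cut = least (¬? ∘ Crossed?) q≤n λ crossed →
      let e , e∈ , _ , n<a = find∈ crossed in <⇒≱ n<a (proj₂ (pref-bounds e∈))

    t : ℕ
    t = proj₁ cut

    q≤t : q ≤ t
    q≤t = proj₁ (proj₂ cut)

    t≤n : t ≤ n
    t≤n = proj₁ (proj₂ (proj₂ cut))

    pref≤t : ∀ {e} → e ∈ entries → InBlock t e → pref e ≤ t
    pref≤t e∈ b = ≮⇒≥ λ t<a → proj₁ (proj₂ (proj₂ (proj₂ cut))) (lose e∈ (b , t<a))

    crosser : ∀ {i} → q ≤ i → i < t → ∃[ e ] ∃[ s ] e ∈ entries × spot e ≡ just s × [ suc w ⋯ i ] s × i < pref e
    crosser {i} q≤i i<t =
      let e , e∈ , b , i<a = find∈ (decidable-stable (Crossed? i) (proj₂ (proj₂ (proj₂ (proj₂ cut))) q≤i i<t))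
          s , eq , s∈ = landsIn⁻ e b
      in e , s , e∈ , eq , s∈ , i<a

    -- Up to q this is `interval-occupied`. Beyond q, minimality of t gives a car that prefers the
    -- spot in question or a higher one and lands below it, so it has found that spot taken while
    -- backing up.
    block-occupied : ∀ {x} → [ suc w ⋯ t ] x → Occupied x
    block-occupied {x} (w+1≤x , x≤t) with x ≤? q
    ... | yes x≤q = interval-occupied (w+1≤x , x≤q)
    block-occupied {zero}  (w+1≤x , x≤t) | no x≰q = contradiction z≤n x≰q
    block-occupied {suc x} (w+1≤x , x≤t) | no x≰q =
      let e , s , e∈ , eq , (_ , s≤x) , x<a = crosser (s≤s⁻¹ (≰⇒> x≰q)) x≤t
          p , b = backward-passes e∈ eq (s≤s s≤x) x<a
      in passed⇒occupied e∈ eq p b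

    blockEntries : List Entry
    blockEntries = filter (InBlock? t) entries

    length-block : length blockEntries + suc w ≡ suc t
    length-block = ≤-antisym
      (landings-≤ (InBlock? t) (≤-trans w+1≤q (m≤n⇒m≤1+n q≤t)) (λ {e} _ b → landsIn⁻ e b))
      (landings-≥ (InBlock? t) λ s w+1≤s s≤t →
        let e , e∈ , eq = occupied⁻ (block-occupied (w+1≤s , s≤t)) in e , e∈ , landsIn⁺ eq w+1≤s s≤t , eq)

    -- A car preferring a spot beyond f stops at f+1 at the latest if it arrives before e; if it arrives
    -- after e, all spots up to f within its reach have been found occupied by e.
    forward⇒¬Crossed : ∀ {e f} → e ∈ entries → spot e ≡ just (suc f) → pref e < suc f → ¬ Crossed f
    forward⇒¬Crossed {e} {f} e∈ eq a<1+f crossed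
      with e′ , e′∈ , b , f<a′ ← find∈ crossed
      with s , eq′ , _ , s≤f ← landsIn⁻ e′ b
      with ((1≤s , s≤n) , a′≤s+k) , s∉ , passed′ ← lands e′∈ eq′
         | _ , f∉ , passed ← lands e∈ eq
      with AllPairs-lookup (log-ordered [] as) e∈ e′∈
    ... | inj₁ refl = contradiction (just-injective (trans (sym eq) eq′)) (>⇒≢ (s≤s s≤f))
    ... | inj₂ (inj₁ e≺e′) = s∉ (e≺e′ (after-⊇ e (passed s
            ((1≤s , s≤n) , ≤-trans (<⇒≤ (<-≤-trans a<1+f f<a′)) a′≤s+k) (inj₁ (s≤s s≤f , a<1+f)))))
    ... | inj₂ (inj₂ e′≺e) = f∉ (e′≺e (after-⊇ e′ (let p , b = backward-passes e′∈ eq′ (s≤s s≤f) f<a′ in passed′ (suc f) p b)))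

    -- For i ≤ q, the block has at most as many cars preferring less than i as the whole run, and
    -- `heavy` bounds those; the rest of its t-p+2 cars suffice. For i > q, the cars landing in
    -- [i,t] all prefer i or more, and a car crossing i-1 backwards is one more.
    block-heavy : ∀ {i} → [ 2 + w ⋯ t ] i → 2 + t ≤ length (filter (prefers≥? i) blockEntries) + i
    block-heavy {i} (w+2≤i , i≤t) with i ≤? q
    ... | yes i≤q = arith (length (filter (∁? (prefers≥? i)) blockEntries)) (length (filter (prefers≥? i) blockEntries))
        (countBelow i) (countFrom as i)
        (trans (cong (_+ suc w) (length-filter-∁ (prefers≥? i) blockEntries)) length-block)
        (length-filter-filter (∁? (prefers≥? i)) (InBlock? t) entries)
        (total-split i) (heavy (w+2≤i , i≤q))
      where
      arith : ∀ K L N M → K + L + suc w ≡ suc t → K ≤ N → N + M + (2 + w) ≡ 2 + n → 2 + n ≤ M + i → 2 + t ≤ L + i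
      arith K L N M eq K≤N eq′ 2+n≤ = begin
        2 + t                ≡⟨ cong suc eq ⟨
        suc (K + L + suc w)  ≡⟨ regroup₁ K L w ⟩
        L + (K + (2 + w))    ≤⟨ +-monoʳ-≤ L (+-cancelˡ-≤ M _ _ K+2+w≤i) ⟩
        L + i                ∎
        where
        open ≤-Reasoning
        regroup₁ : ∀ a b c → suc (a + b + suc c) ≡ b + (a + (2 + c))
        regroup₁ = solve-∀
        regroup₂ : ∀ a b c → a + (b + (2 + c)) ≡ b + a + (2 + c)
        regroup₂ = solve-∀
        K+2+w≤i : M + (K + (2 + w)) ≤ M + i
        K+2+w≤i = begin
          M + (K + (2 + w))  ≤⟨ +-monoʳ-≤ M (+-monoˡ-≤ (2 + w) K≤N) ⟩
          M + (N + (2 + w))  ≡⟨ regroup₂ M N w ⟩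
          N + M + (2 + w)    ≡⟨ eq′ ⟩
          2 + n              ≤⟨ 2+n≤ ⟩
          M + i              ∎
    block-heavy {zero}  (() , _) | no _
    block-heavy {suc i} (w+2≤i , i≤t) | no i≰q
      with e , s , e∈ , eq , (w+1≤s , s≤i) , i<a ← crosser (s≤s⁻¹ (≰⇒> i≰q)) i≤t =
      subst (λ es → 2 + t ≤ length es + suc i) (sym (filter-filter (prefers≥? (suc i)) (InBlock? t) both? (λ p b → b , p) swap entries))
        (landings-> both? cover e∈ (landsIn⁺ eq w+1≤s (≤-trans s≤i (<⇒≤ i≤t)) , i<a)
          λ eq′ (i<s′ , _) → <⇒≱ i<s′ (subst (_≤ i) (just-injective (trans (sym eq) eq′)) s≤i))
      where
      both? : Decidable (λ e → InBlock t e × suc i ≤ pref e)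
      both? = InBlock? t ∩? prefers≥? (suc i)
      q≤i : q ≤ i
      q≤i = s≤s⁻¹ (≰⇒> i≰q)
      cover : ∀ s → suc i ≤ s → s ≤ t → ∃[ e ] e ∈ entries × (InBlock t e × suc i ≤ pref e) × spot e ≡ just s
      cover (suc f) i<s s≤t
        with e , e∈ , eq ← occupied⁻ (block-occupied (≤-trans (<⇒≤ w+2≤i) i<s , s≤t)) =
        e , e∈ , (landsIn⁺ eq (≤-trans (<⇒≤ w+2≤i) i<s) s≤t , ≮⇒≥ λ a<1+i →
          -- Since q ≤ f < t, minimality of t makes f crossed, whereas a car reaching f+1 from below
          -- rules that out.
          proj₂ (proj₂ (proj₂ (proj₂ cut))) (≤-trans q≤i (s≤s⁻¹ i<s)) s≤t
            (forward⇒¬Crossed e∈ eq (<-≤-trans a<1+i i<s))) , eq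

-- The excess function and maximal intervals

length-filter-≡ : ∀ {xs} → Unique xs → x ∈ xs → length (filter (x ≟_) xs) ≡ 1
length-filter-≡ {x} {xs} xs! x∈xs = ≤-antisym
  (unique-⊆⇒length≤ {ys = x ∷ []} (Unique.filter⁺ (x ≟_) xs!) λ y∈ → here (sym (proj₂ (∈-filter⁻ (x ≟_) {xs = xs} y∈))))
  (filter-some (x ≟_) x∈xs)

-- A new car raises the multiplicity of its own preference only, so the sum grows by the number of
-- occurrences of that preference in the list.
sum-mult-∷ : ∀ a (α : Vec ℕ n) xs →
  sum (map (mult (a ∷ α)) xs) ≡ length (filter (a ≟_) xs) + sum (map (mult α) xs)
sum-mult-∷ a α [] = refl
-- Both `mult` and the filter test `a ≟ x`, whose boolean is `a ≡ᵇ x`; one case split reduces both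
-- sides.
sum-mult-∷ a α (x ∷ xs) with a ≡ᵇ x
... | true  = cong suc (trans (cong (mult α x +_) (sum-mult-∷ a α xs)) (x∙yz≈y∙xz (mult α x) (length (filter (a ≟_) xs)) _))
... | false = trans (cong (mult α x +_) (sum-mult-∷ a α xs)) (x∙yz≈y∙xz (mult α x) (length (filter (a ≟_) xs)) _)

-- Double counting: a car with preference a ≤ n contributes once if j ≤ a, since the range has no
-- repetitions, and otherwise not at all.
sum-mult : ∀ {m j} (α : Vec ℕ m) → VecAll.All (_≤ n) α →
  sum (map (mult α) (range j n)) ≡ countFrom (toList α) j
sum-mult {n} {j = j} [] VecAll.[] = sum-zeros (range j n)
  where
  sum-zeros : ∀ xs → sum (map (mult []) xs) ≡ 0
  sum-zeros []       = refl
  sum-zeros (_ ∷ xs) = sum-zeros xs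
sum-mult {n} {j = j} (a ∷ α) (a≤n VecAll.∷ α≤n) =
  trans (sum-mult-∷ a α (range j n)) (trans (cong (length (filter (a ≟_) (range j n)) +_) (sum-mult α α≤n)) add)
  where
  add : length (filter (a ≟_) (range j n)) + countFrom (toList α) j ≡ countFrom (a ∷ toList α) j
  add with j ≤? a
  ... | yes j≤a = trans (cong (_+ countFrom (toList α) j) (length-filter-≡ (range-unique j n) (∈-range⁺ j≤a a≤n)))
          (cong length (sym (filter-accept (j ≤?_) j≤a)))
  ... | no  j≰a = trans (cong (_+ countFrom (toList α) j) (cong length (filter-none (a ≟_)
          (All.tabulate λ x∈ a≡x → j≰a (subst (j ≤_) (sym a≡x) (proj₁ (∈-range⁻ j n x∈)))))))
          (cong length (sym (filter-reject (j ≤?_) j≰a)))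

private
  excess-shift : ∀ c n j → (c ℤ.- (n ℤ.- j ℤ.+ ℤ.+ 1)) ℤ.+ (n ℤ.+ ℤ.+ 1) ≡ c ℤ.+ j
  excess-shift = ℤ.solve-∀

-- The inequality u(j) ≥ 1 with its subtraction cleared: n+1 is added to both sides, which leaves an
-- inequality of naturals.
Heavy : Vec ℕ n → Pred ℕ 0ℓ
Heavy {n} α j = 2 + n ≤ countFrom (toList α) j + j

module _ {α : Vec ℕ n} (α∈ : IsPP α) where

  private
    2+n≡ : ℤ.+ 1 ℤ.+ (ℤ.+ n ℤ.+ ℤ.+ 1) ≡ ℤ.+ (2 + n)
    2+n≡ = cong (λ m → ℤ.+ suc m) (+-comm n 1)

    excess≡ : ∀ j → excess α j ℤ.+ (ℤ.+ n ℤ.+ ℤ.+ 1) ≡ ℤ.+ (countFrom (toList α) j + j)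
    excess≡ j = trans (excess-shift (ℤ.+ _) (ℤ.+ n) (ℤ.+ j))
      (cong (λ c → ℤ.+ (c + j)) (sum-mult α (VecAll.map proj₂ α∈)))

  U⇒Heavy : ∀ {j} → U α j → Heavy α j
  U⇒Heavy {j} (_ , 1≤u) = ℤ.drop‿+≤+ (subst₂ ℤ._≤_ 2+n≡ (excess≡ j) (ℤ.+-monoˡ-≤ _ 1≤u))

  Heavy⇒U : ∀ {j} → [ 1 ⋯ n ] j → Heavy α j → U α j
  Heavy⇒U {j} j∈ heavy = j∈ , ℤ.≮⇒≥ λ u<1 →
    ℤ.<⇒≱ (subst₂ ℤ._<_ (excess≡ j) 2+n≡ (ℤ.+-monoˡ-< _ u<1)) (ℤ.+≤+ heavy)

  ¬U⇒light : ∀ {j} → [ 1 ⋯ n ] j → ¬ U α j → countFrom (toList α) j + j ≤ suc n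
  ¬U⇒light j∈ ¬u = s≤s⁻¹ (≰⇒> (¬u ∘ Heavy⇒U j∈))

  ¬Heavy-1 : ¬ Heavy α 1
  ¬Heavy-1 heavy = 1+n≰n (≤-trans heavy (subst (countFrom (toList α) 1 + 1 ≤_) (+-comm n 1) (+-monoˡ-≤ 1 (begin
    countFrom (toList α) 1  ≤⟨ length-filter (1 ≤?_) (toList α) ⟩
    length (toList α)       ≡⟨ Vec.length-toList α ⟩
    n                       ∎))))
    where open ≤-Reasoning

  U⇒2≤ : ∀ {j} → U α j → 2 ≤ j
  U⇒2≤ {zero}        ((() , _) , _)
  U⇒2≤ {suc zero}    u = contradiction (U⇒Heavy u) ¬Heavy-1
  U⇒2≤ {suc (suc _)} _ = s≤s (s≤s z≤n)

  U? : Decidable (U α)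
  U? j with 1 ≤? j ×-dec j ≤? n | 2 + n ≤? countFrom (toList α) j + j
  ... | yes j∈ | yes heavy = yes (Heavy⇒U j∈ heavy)
  ... | yes _  | no ¬heavy = no (¬heavy ∘ U⇒Heavy)
  ... | no ¬j∈ | _         = no (¬j∈ ∘ proj₁)

module _ {V : Pred ℕ 0ℓ} where

  maximal-right : ∀ {p q} → MaximalInterval V p q → ¬ V (suc q)
  maximal-right {p} {q} (p≤q , ⊆V , max) Vq+1 =
    1+n≰n (proj₂ (max p (suc q) ⊆V′ (λ (p≤x , x≤q) → p≤x , m≤n⇒m≤1+n x≤q) (m≤n⇒m≤1+n p≤q , ≤-refl)))
    where
    ⊆V′ : ∀ {x} → [ p ⋯ suc q ] x → V x
    ⊆V′ (p≤x , x≤1+q) with m≤n⇒m<n∨m≡n x≤1+q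
    ... | inj₁ x<1+q = ⊆V (p≤x , s≤s⁻¹ x<1+q)
    ... | inj₂ refl  = Vq+1

  maximal-left : ∀ {p q} → MaximalInterval V (suc p) q → ¬ V p
  maximal-left {p} {q} (p<q , ⊆V , max) Vp =
    1+n≰n (proj₁ (max p q ⊆V′ (λ (p<x , x≤q) → <⇒≤ p<x , x≤q) (≤-refl , <⇒≤ p<q)))
    where
    ⊆V′ : ∀ {x} → [ p ⋯ q ] x → V x
    ⊆V′ (p≤x , x≤q) with m≤n⇒m<n∨m≡n p≤x
    ... | inj₁ p<x  = ⊆V (p<x , x≤q)
    ... | inj₂ refl = Vp

  module _ (V? : Decidable V) (¬V0 : ¬ V 0) (V≤n : ∀ {x} → V x → x ≤ n) where

    -- The left end has the form `suc p`, so that its neighbour outside V is the natural number p;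
    -- `¬V0` stops the descent in time.
    left-end : ∀ x → V x → ∃[ p ] suc p ≤ x × (∀ {y} → [ suc p ⋯ x ] y → V y) × ¬ V p
    left-end zero V0 = contradiction V0 ¬V0
    left-end (suc x) Vx+1 with V? x
    ... | no ¬Vx = x , ≤-refl , (λ (x<y , y≤1+x) → subst V (≤-antisym x<y y≤1+x) Vx+1) , ¬Vx
    ... | yes Vx with p , p<x , ⊆V , ¬Vp ← left-end x Vx = p , m≤n⇒m≤1+n p<x , ⊆V′ , ¬Vp
      where
      ⊆V′ : ∀ {y} → [ suc p ⋯ suc x ] y → V y
      ⊆V′ (p<y , y≤1+x) with m≤n⇒m<n∨m≡n y≤1+x
      ... | inj₁ y<1+x = ⊆V (p<y , s≤s⁻¹ y<1+x)
      ... | inj₂ refl  = Vx+1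

    maximal-interval : V x → ∃[ p ] ∃[ q ] MaximalInterval V p q × [ p ⋯ q ] x
    maximal-interval {x} Vx
      with p , p<x , ⊆V , ¬Vp ← left-end x Vx
      -- The right end is the least index from x on whose successor leaves V; n qualifies, as V has
      -- no element above n.
      with q , x≤q , _ , ¬Vq+1 , min ← least (¬? ∘ V? ∘ suc) (V≤n Vx) (λ Vn+1 → 1+n≰n (V≤n Vn+1)) =
      suc p , q , (≤-trans p<x x≤q , ⊆V′ , max) , p<x , x≤q
      where
      ⊆V′ : ∀ {y} → [ suc p ⋯ q ] y → V y
      ⊆V′ {y} (p<y , y≤q) with y ≤? x
      ... | yes y≤x = ⊆V (p<y , y≤x)
      ⊆V′ {zero}  (() , _)     | no y≰x
      ⊆V′ {suc y} (p<y , y<q) | no y≰x = decidable-stable (V? (suc y)) (min (s≤s⁻¹ (≰⇒> y≰x)) y<q)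
      max : ∀ p′ q′ → (∀ {y} → [ p′ ⋯ q′ ] y → V y) → (∀ {y} → [ suc p ⋯ q ] y → [ p′ ⋯ q′ ] y) →
        ∀ {y} → [ p′ ⋯ q′ ] y → [ suc p ⋯ q ] y
      max p′ q′ ⊆V″ ⊇ (p′≤y , y≤q′) with ⊇ (≤-refl , ≤-trans p<x x≤q) | ⊇ (≤-trans p<x x≤q , ≤-refl)
      ... | p′≤p+1 , p+1≤q′ | p′≤q , q≤q′ =
        ≮⇒≥ (λ y<p+1 → ¬Vp (⊆V″ (≤-trans p′≤y (s≤s⁻¹ y<p+1) , <⇒≤ p+1≤q′))) ,
        ≮⇒≥ (λ q<y → ¬Vq+1 (⊆V″ (m≤n⇒m≤1+n p′≤q , ≤-trans q<y y≤q′)))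

-- Restriction and shift

lookup-restrict : ∀ {J : Subset n} {α : Vec ℕ n} {j} → j Subset.∈ J → lookup α j ∈ toList (restrict J α)
lookup-restrict {J = true  ∷ J} {a ∷ α} here       = here refl
lookup-restrict {J = true  ∷ J} {a ∷ α} (there j∈) = there (lookup-restrict j∈)
lookup-restrict {J = false ∷ J} {a ∷ α} (there j∈) = lookup-restrict j∈

lookup⇒restrict : ∀ {P : ℕ → Set} (J : Subset n) (α : Vec ℕ n) →
  (∀ j → j Subset.∈ J → P (lookup α j)) → VecAll.All P (restrict J α)
lookup⇒restrict []          []      P∈ = VecAll.[]
lookup⇒restrict (true  ∷ J) (a ∷ α) P∈ = P∈ zero here VecAll.∷ lookup⇒restrict J α λ j j∈ → P∈ (suc j) (there j∈)
lookup⇒restrict (false ∷ J) (a ∷ α) P∈ = lookup⇒restrict J α λ j j∈ → P∈ (suc j) (there j∈)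

∣J∣≤countFrom : ∀ {p} (J : Subset n) (α : Vec ℕ n) → VecAll.All (p ≤_) (restrict J α) →
  ∣ J ∣ ≤ countFrom (toList α) p
∣J∣≤countFrom []          []      _  = z≤n
∣J∣≤countFrom {p = p} (true  ∷ J) (a ∷ α) (p≤a VecAll.∷ p≤) =
  subst (suc ∣ J ∣ ≤_) (cong length (sym (filter-accept (p ≤?_) p≤a))) (s≤s (∣J∣≤countFrom J α p≤))
∣J∣≤countFrom {p = p} (false ∷ J) (a ∷ α) p≤ with does (p ≤? a)
... | true  = m≤n⇒m≤1+n (∣J∣≤countFrom J α p≤)
... | false = ∣J∣≤countFrom J α p≤

module _ (n k : ℕ) where
  open Run n k

  module _ {P : ℕ → Set} (P? : Decidable P) {Q : Entry → Set} (Q? : Decidable Q) where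

    -- The condition `Q?` concerns the run of the cars satisfying `P?` alone. The recursion
    -- therefore carries the occupied list of that run, which the other cars leave unchanged.
    chosen : ∀ {r} (O : List ℕ) (α : Vec ℕ r) → Subset r
    chosen O []      = []
    chosen O (a ∷ α) = if does (P? a) then does (Q? (O , a)) ∷ chosen (after (O , a)) α else false ∷ chosen O α

    restrict-chosen : ∀ {r} O (α : Vec ℕ r) →
      toList (restrict (chosen O α) α) ≡ map pref (filter Q? (log O (filter P? (toList α))))
    restrict-chosen O []      = refl
    restrict-chosen O (a ∷ α) with does (P? a)
    ... | false = restrict-chosen O α
    ... | true with does (Q? (O , a))
    ...   | true  = cong (a ∷_) (restrict-chosen _ α)
    ...   | false = restrict-chosen _ α

  -- Translation between the street and its segment from w+1 to w+m

  module _ (m w : ℕ) (w+m≤n : w + m ≤ n) where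

    unshift : [ suc w ⋯ w + m ] x → ∃[ y ] x ≡ w + y × [ 1 ⋯ m ] y
    unshift {x} (w<x , x≤w+m) with y , refl ← m≤n⇒∃[o]m+o≡n (<⇒≤ w<x) =
      y , refl , +-cancelˡ-≤ w _ _ (subst (_≤ w + y) (+-comm 1 w) w<x) , +-cancelˡ-≤ w _ _ x≤w+m

    Before-shift : ∀ {a x y} → Before a x y → Before (w + a) (w + x) (w + y)
    Before-shift (inj₁ (x<y , a<y)) = inj₁ (+-monoʳ-< w x<y , +-monoʳ-< w a<y)
    Before-shift (inj₂ (y<x , x≤a)) = inj₂ (+-monoʳ-< w y<x , +-monoʳ-≤ w x≤a)

    Before-unshift : ∀ {a x y} → Before (w + a) (w + x) (w + y) → Before a x y
    Before-unshift (inj₁ (x<y , a<y)) = inj₁ (+-cancelˡ-< w _ _ x<y , +-cancelˡ-< w _ _ a<y)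
    Before-unshift (inj₂ (y<x , x≤a)) = inj₂ (+-cancelˡ-< w _ _ y<x , +-cancelˡ-≤ w _ _ x≤a)

    Probed-shift : ∀ {a x} → Probed m k a x → Probed n k (w + a) (w + x)
    Probed-shift {a} {x} ((1≤x , x≤m) , a≤x+k) =
      (≤-trans 1≤x (m≤n+m x w) , ≤-trans (+-monoʳ-≤ w x≤m) w+m≤n) ,
      subst (w + a ≤_) (sym (+-assoc w x k)) (+-monoʳ-≤ w a≤x+k)

    Probed-unshift : ∀ {a x} → [ 1 ⋯ m ] x → Probed n k (w + a) (w + x) → Probed m k a x
    Probed-unshift {a} {x} x∈ (_ , a≤x+k) = x∈ , +-cancelˡ-≤ w _ _ (subst (w + a ≤_) (+-assoc w x k) a≤x+k)

    -- Preference and landing spot lie in the segment, and every spot probed on the small street is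
    -- probed on the large one after translation. Agreement of the occupied lists on the segment
    -- therefore suffices.
    park-shift : ∀ {O O′} → (∀ {x} → [ 1 ⋯ m ] x → x ∈ O′ → w + x ∈ O) → (∀ {x} → [ 1 ⋯ m ] x → w + x ∈ O → x ∈ O′) →
      [ suc w ⋯ w + m ] a → [ suc w ⋯ w + m ] s → park n k O a ≡ just s → park m k O′ (a ∸ w) ≡ just (s ∸ w)
    park-shift {O = O} {O′} O′⇒O O⇒O′ a∈ s∈ eq
      with a , refl , a∈@(1≤a , a≤m) ← unshift a∈ | s , refl , s∈ ← unshift s∈
      with ps , s∉O , first ← park-just⁻ n k O (≤-trans 1≤a (m≤n+m a w) , ≤-trans (+-monoʳ-≤ w a≤m) w+m≤n) eq =
      subst₂ (λ b t → park m k O′ b ≡ just t) (sym (m+n∸m≡n w a)) (sym (m+n∸m≡n w s))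
        (park-just⁺ m k O′ a∈ (Probed-unshift s∈ ps , s∉O ∘ O′⇒O s∈ ,
          λ x px x≺s → O⇒O′ (proj₁ px) (first (w + x) (Probed-shift px) (Before-shift x≺s))))

    -- A car landing outside the segment, or failing, does not change which spots of the segment are
    -- occupied and can be deleted. A car landing inside takes the translated spot by `park-shift`.
    replay : ∀ {O O′} as → (∀ {x} → [ 1 ⋯ m ] x → x ∈ O′ → w + x ∈ O) → (∀ {x} → [ 1 ⋯ m ] x → w + x ∈ O → x ∈ O′) →
      All (λ e → LandsIn (suc w) (w + m) e → [ suc w ⋯ w + m ] (pref e)) (log O as) →
      All Is-just (outcomesFrom m k O′ (map (_∸ w) (map pref (filter (LandsIn? (suc w) (w + m)) (log O as)))))
    replay [] _ _ _ = []
    replay {O} {O′} (a ∷ as) O′⇒O O⇒O′ (a∈ ∷ as∈) with LandsIn? (suc w) (w + m) (O , a)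
    ... | no ¬lands = replay as (λ x∈ → after-⊇ (O , a) ∘ O′⇒O x∈) after⇒O′ as∈
      where
      after⇒O′ : ∀ {x} → [ 1 ⋯ m ] x → w + x ∈ after (O , a) → x ∈ O′
      after⇒O′ {x} x∈@(1≤x , x≤m) w+x∈ with ∈-after⁻ {e = O , a} w+x∈
      ... | inj₂ w+x∈O = O⇒O′ x∈ w+x∈O
      ... | inj₁ eq    = contradiction (landsIn⁺ {e = O , a} eq (m<m+n w 1≤x) (+-monoʳ-≤ w x≤m)) ¬lands
    ... | yes b with s , eq , s∈ ← landsIn⁻ (O , a) b
                with eq′ ← park-shift {O = O} {O′} O′⇒O O⇒O′ (a∈ b) s∈ eq
                rewrite eq′ = MaybeAny.just tt ∷ replay as ⇒after after⇒ as∈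
      where
      s≡ : w + (s ∸ w) ≡ s
      s≡ = m+[n∸m]≡n (<⇒≤ (proj₁ s∈))
      ⇒after : ∀ {x} → [ 1 ⋯ m ] x → x ∈ s ∸ w ∷ O′ → w + x ∈ after (O , a)
      ⇒after x∈ (here refl)  = ∈-after (O , a) (trans eq (cong just (sym s≡)))
      ⇒after x∈ (there x∈O′) = after-⊇ (O , a) (O′⇒O x∈ x∈O′)
      after⇒ : ∀ {x} → [ 1 ⋯ m ] x → w + x ∈ after (O , a) → x ∈ s ∸ w ∷ O′
      after⇒ {x} x∈ w+x∈ with ∈-after⁻ {e = O , a} w+x∈
      ... | inj₂ w+x∈O = there (O⇒O′ x∈ w+x∈O)
      ... | inj₁ eq″   = here (trans (sym (m+n∸m≡n w x)) (cong (_∸ w) (just-injective (trans (sym eq″) eq))))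

    -- Unless `w + s` is already taken, the car takes it here too: earlier spots of the segment are
    -- occupied by translation, and the freeness of w+1 excludes that the car has searched at or
    -- below w.
    park-embed : ∀ {O O′} → (∀ {x} → x ∈ O′ → w + x ∈ O) → suc w ∉ O →
      [ 2 + w ⋯ w + m ] a → park m k O′ (a ∸ w) ≡ just s → w + s ∈ after (O , a)
    park-embed {s = s} {O = O} {O′} O′⇒O free (w+2≤a , a≤w+m) eq
      with a , refl , a∈@(1≤a , a≤m) ← unshift (<⇒≤ w+2≤a , a≤w+m)
      with ps@(s∈ , a≤s+k) , _ , first ← park-just⁻ m k O′ a∈ (subst (λ b → park m k O′ b ≡ just s) (m+n∸m≡n w a) eq)
      with w + s ∈? O
    ... | yes s∈O = after-⊇ (O , w + a) s∈O
    ... | no  s∉O = ∈-after (O , w + a) (park-just⁺ n k O (≤-trans 1≤a (m≤n+m a w) , ≤-trans a≤w+m w+m≤n)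
                      (Probed-shift ps , s∉O , first′))
      where
      2≤a : 2 ≤ a
      2≤a = +-cancelˡ-≤ w _ _ (subst (_≤ w + a) (+-comm 2 w) w+2≤a)
      first-free : Before a 1 s → ¬ a ≤ 1 + k
      first-free 1≺s a≤1+k = free (subst (_∈ O) (+-comm w 1)
        (O′⇒O (first 1 ((≤-refl , ≤-trans 1≤a a≤m) , a≤1+k) 1≺s)))
      x≤w+m : ∀ {x} → Before (w + a) x (w + s) → x ≤ w + m
      x≤w+m (inj₁ (x<w+s , _)) = ≤-trans (<⇒≤ x<w+s) (+-monoʳ-≤ w (proj₂ s∈))
      x≤w+m (inj₂ (_ , x≤w+a)) = ≤-trans x≤w+a a≤w+m
      first′ : ∀ x → Probed n k (w + a) x → Before (w + a) x (w + s) → x ∈ O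
      first′ x px x≺s with x ≤? w
      first′ x px (inj₂ (w+s<x , _)) | yes x≤w = contradiction (≤-trans x≤w (m≤m+n w s)) (<⇒≱ w+s<x)
      -- A car going forward that reaches a spot at or below w has w+1 within reach. On the small
      -- street it has then passed spot 1, so w+1 would be occupied.
      first′ x (_ , w+a≤x+k) (inj₁ (_ , w+a<w+s)) | yes x≤w = contradiction
        (m≤n⇒m≤1+n (+-cancelˡ-≤ w _ _ (≤-trans w+a≤x+k (+-monoˡ-≤ k x≤w))))
        (first-free (inj₁ (≤-trans 2≤a (<⇒≤ a<s) , a<s)))
        where
        a<s : a < s
        a<s = +-cancelˡ-< w _ _ w+a<w+s
      first′ x px x≺s | no x≰w with y , refl , y∈ ← unshift (≰⇒> x≰w , x≤w+m x≺s) =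
        O′⇒O (first y (Probed-unshift y∈ px) (Before-unshift x≺s))

    -- Along the run w+1 remains free because it is never taken, so `park-embed` applies to each car
    -- of J. The other cars only enlarge the occupied list of the large street.
    embed : ∀ {P : ℕ → Set} (P? : Decidable P) {r O O′} (α : Vec ℕ r) (J : Subset r) →
      (∀ j → j Subset.∈ J → P (lookup α j)) → (∀ j → j Subset.∈ J → [ 2 + w ⋯ w + m ] (lookup α j)) →
      (∀ {x} → x ∈ O′ → w + x ∈ O) → suc w ∉ O →
      just (suc w) ∉ outcomesFrom n k O (filter P? (toList α)) →
      just x ∈ outcomesFrom m k O′ (map (_∸ w) (toList (restrict J α))) →
      w + x ∈ O ⊎ just (w + x) ∈ outcomesFrom n k O (filter P? (toList α))
    embed P? [] [] _ _ _ _ _ ()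
    embed P? (a ∷ α) (false ∷ J) P∈ bounds O′⇒O free never x∈ with does (P? a)
    ... | false = embed P? α J (λ j j∈ → P∈ (suc j) (there j∈)) (λ j j∈ → bounds (suc j) (there j∈)) O′⇒O free never x∈
    ... | true  = just∈-∷⁺ (embed P? α J (λ j j∈ → P∈ (suc j) (there j∈)) (λ j j∈ → bounds (suc j) (there j∈)) (after-⊇ _ ∘ O′⇒O)
        ([ free , never ]′ ∘ just∈-∷⁺ ∘ inj₁) (never ∘ there) x∈)
    embed {x = x} P? {O = O} {O′} (a ∷ α) (true ∷ J) P∈ bounds O′⇒O free never x∈ with P? a
    ... | no ¬Pa = contradiction (P∈ zero here) ¬Pa
    ... | yes _ = just∈-∷⁺ ([ inj₁ ∘ ⇒after ,
            embed P? α J (λ j j∈ → P∈ (suc j) (there j∈)) (λ j j∈ → bounds (suc j) (there j∈)) ⇒after ([ free , never ]′ ∘ just∈-∷⁺ ∘ inj₁) (never ∘ there) ]′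
            (just∈-∷⁻ x∈))
      where
      ⇒after : ∀ {y} → y ∈ Run.after m k (O′ , a ∸ w) → w + y ∈ after (O , a)
      ⇒after y∈ with Run.∈-after⁻ m k {e = O′ , a ∸ w} y∈
      ... | inj₁ eq   = park-embed O′⇒O free (bounds zero here) eq
      ... | inj₂ y∈O′ = after-⊇ (O , a) (O′⇒O y∈O′)

-- The equivalence of (i) and (ii), and the characterization of parking functions

module _ {n : ℕ} (k : ℕ) (α : Vec ℕ n) (α∈ : IsPP α) where

  private
    cars : List ℕ
    cars = toList α

    cars∈ : All [ 1 ⋯ n ] cars
    cars∈ = VecAll.toList⁺ α∈

    carsFrom : ℕ → List ℕ
    carsFrom p = filter (p ≤?_) cars

  record IntervalData (w q : ℕ) : Set where
    field
      w+2≤q : 2 + w ≤ q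
      q≤n   : q ≤ n
      total : countFrom cars (2 + w) + (2 + w) ≡ 2 + n
      heavy : ∀ {i} → [ 2 + w ⋯ q ] i → Heavy α i
      light : countFrom cars (suc q) + q ≤ n

  -- For `total`, p in U gives at least n-p+2 cars preferring p or more, and p-1 outside U allows at
  -- most n-p+2 preferring p-1 or more. For `light`, q+1 is outside U, or q = n and no preference
  -- exceeds n.
  intervalData : ∀ p q → MaximalInterval (U α) p q → ∃[ w ] p ≡ 2 + w × IntervalData w q
  intervalData p q max@(p≤q , ⊆U , _) with U⇒2≤ α∈ (⊆U (≤-refl , p≤q))
  intervalData (suc (suc w)) q max@(p≤q , ⊆U , _) | s≤s (s≤s _) = w , refl , record
    { w+2≤q = p≤q
    ; q≤n   = q≤n
    ; total = ≤-antisym (≤-trans (≤-reflexive (+-suc _ (suc w))) (s≤s (≤-trans (+-monoˡ-≤ (suc w) antitone)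
                (¬U⇒light α∈ (s≤s z≤n , ≤-trans (<⇒≤ p≤q) q≤n) (maximal-left max)))))
                (U⇒Heavy α∈ (⊆U (≤-refl , p≤q)))
    ; heavy = λ i∈ → U⇒Heavy α∈ (⊆U i∈)
    ; light = light
    }
    where
    q≤n : q ≤ n
    q≤n = proj₂ (proj₁ (⊆U (p≤q , ≤-refl)))
    antitone : countFrom cars (2 + w) ≤ countFrom cars (suc w)
    antitone = subst (_≤ countFrom cars (suc w))
      (cong length (filter-filter (2 + w ≤?_) (suc w ≤?_) (2 + w ≤?_) (λ p _ → p) (λ p → p , <⇒≤ p) cars))
      (length-filter (2 + w ≤?_) (carsFrom (suc w)))
    light : countFrom cars (suc q) + q ≤ n
    light with m≤n⇒m<n∨m≡n q≤n
    ... | inj₁ q<n  = s≤s⁻¹ (subst (_≤ suc n) (+-suc _ q) (¬U⇒light α∈ (s≤s z≤n , q<n) (maximal-right max)))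
    ... | inj₂ refl = subst (λ c → c + n ≤ n)
      (cong length (sym (filter-none (suc n ≤?_) (All.map (λ (_ , a≤n) → <⇒≱ (s≤s a≤n)) cars∈)))) ≤-refl

  module _ {w q : ℕ} (interval : IntervalData w q) where
    open IntervalData interval
    open Run n k

    private
      p : ℕ
      p = 2 + w

      countFrom-carsFrom : ∀ {i} → p ≤ i → countFrom (carsFrom p) i ≡ countFrom cars i
      countFrom-carsFrom {i} p≤i =
        cong length (filter-filter (i ≤?_) (p ≤?_) (i ≤?_) (λ i≤ _ → i≤) (λ i≤ → i≤ , ≤-trans p≤i i≤) cars)

    open Block n k w q (carsFrom p) (All.filter⁺ (p ≤?_) cars∈) (All.all-filter (p ≤?_) cars) w+2≤q q≤n total
      (λ {i} i∈ → subst (λ c → 2 + n ≤ c + i) (sym (countFrom-carsFrom (proj₁ i∈))) (heavy i∈))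
      (subst (λ c → c + q ≤ n) (sym (countFrom-carsFrom (m≤n⇒m≤1+n w+2≤q))) light)
      public
    open Street (carsFrom p) (All.filter⁺ (p ≤?_) cars∈)

    preceding⇒complete : PrecedingSpotOccupied k α p → HasCompleteRestriction k α p q
    preceding⇒complete occupied-w+1 = J , size<m , bounds , (β∈ , parks) , 2≤m , β∈ , U⊆ , ⊆U
      where
      t′ : ℕ
      t′ = t occupied-w+1
      block : List Entry
      block = blockEntries occupied-w+1
      J : Subset n
      J = chosen n k (p ≤?_) (InBlock? occupied-w+1 t′) [] α
      m : ℕ
      m = ∣ J ∣
      β : Vec ℕ m
      β = τ w (restrict J α)
      cars-J : toList (restrict J α) ≡ map pref block
      cars-J = restrict-chosen n k (p ≤?_) (InBlock? occupied-w+1 t′) [] α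
      m≡ : m ≡ length block
      m≡ = trans (sym (Vec.length-toList (restrict J α))) (trans (cong length cars-J) (length-map pref block))
      -- The cars of J fill [p-1,t] exactly, so the segment from w+1 to w+m is [p-1,t].
      t≡ : t′ ≡ w + m
      t≡ = suc-injective (trans (sym (length-block occupied-w+1))
        (trans (cong (_+ suc w) (sym m≡)) (trans (+-suc m w) (cong suc (+-comm m w)))))
      w+m≤n : w + m ≤ n
      w+m≤n = subst (_≤ n) t≡ (t≤n occupied-w+1)
      size<m : suc (size p q) ≤ m
      size<m = +-cancelʳ-≤ (suc w) _ _ (begin
        suc (q ∸ suc w) + suc w  ≡⟨ cong suc (m∸n+n≡m w+1≤q) ⟩
        suc q                    ≤⟨ s≤s (q≤t occupied-w+1) ⟩
        suc t′                   ≡⟨ cong suc t≡ ⟩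
        suc (w + m)              ≡⟨ cong suc (+-comm w m) ⟩
        suc (m + w)              ≡⟨ +-suc m w ⟨
        m + suc w                ∎)
        where open ≤-Reasoning
      2≤m : 2 ≤ m
      2≤m = ≤-trans (s≤s (m<n⇒0<n∸m w+2≤q)) size<m
      block-bounds : ∀ {e} → e ∈ block → [ p ⋯ w + m ] (pref e)
      block-bounds e∈ with e∈ , b ← ∈-filter⁻ (InBlock? occupied-w+1 t′) {xs = entries} e∈ =
        pref≥ e∈ , subst (_ ≤_) t≡ (pref≤t occupied-w+1 e∈ b)
      bounds : ∀ j → j Subset.∈ J → [ p ⋯ w + m ] (lookup α j)
      bounds j j∈ with e , e∈ , eq ← ∈-map⁻ pref (subst (lookup α j ∈_) cars-J (lookup-restrict {α = α} j∈)) =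
        subst [ p ⋯ w + m ] (sym eq) (block-bounds e∈)
      β∈ : IsPP β
      β∈ = VecAll.map⁺ (VecAll.map (λ (p≤a , a≤w+m) → m<n⇒0<n∸m (<⇒≤ p≤a) , m≤n+o⇒m∸n≤o _ w a≤w+m)
        (lookup⇒restrict {P = [ p ⋯ w + m ]} J α bounds))
      cars-β : toList β ≡ map (_∸ w) (map pref block)
      cars-β = trans (Vec.toList-map (_∸ w) (restrict J α)) (cong (map (_∸ w)) cars-J)
      parks : All Is-just (outcomes m k (toList β))
      parks = subst (λ bs → All Is-just (outcomes m k bs)) (sym cars-β)
        (subst (λ u → All Is-just (outcomes m k (map (_∸ w) (map pref (filter (LandsIn? (suc w) u) entries))))) (sym t≡)
          (replay n k m w w+m≤n (carsFrom p) (λ _ ()) (λ _ ()) (All.tabulate λ {e} e∈ b →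
            <⇒≤ (pref≥ e∈) , subst (pref e ≤_) t≡ (pref≤t occupied-w+1 e∈ (subst (λ u → LandsIn (suc w) u e) (sym t≡) b)))))
      -- For positive j, `j ≤ a ∸ w` is equivalent to `w + j ≤ a` even where the subtraction is
      -- truncated.
      count-β : ∀ {j} → 1 ≤ j → countFrom (toList β) j ≡ length (filter (prefers≥? (w + j)) block)
      count-β {suc i} (s≤s _) = begin
        countFrom (toList β) (suc i)
          ≡⟨ cong (λ bs → countFrom bs (suc i)) (trans cars-β (sym (map-∘ block))) ⟩
        length (filter (suc i ≤?_) (map ((_∸ w) ∘ pref) block))
          ≡⟨ cong length (filter-map (suc i ≤?_) ((_∸ w) ∘ pref) block) ⟩
        length (map ((_∸ w) ∘ pref) (filter (λ e → suc i ≤? pref e ∸ w) block))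
          ≡⟨ length-map _ (filter (λ e → suc i ≤? pref e ∸ w) block) ⟩
        length (filter (λ e → suc i ≤? pref e ∸ w) block)
          ≡⟨ cong length (filter-≐ (λ e → suc i ≤? pref e ∸ w) (prefers≥? (w + suc i)) ((λ {e} → ⇒ {e}) , λ {e} → ⇐ {e}) block) ⟩
        length (filter (prefers≥? (w + suc i)) block) ∎
        where
        open ≡-Reasoning
        ⇒ : ∀ {e} → suc i ≤ pref e ∸ w → w + suc i ≤ pref e
        ⇒ {e} j≤ = subst (_≤ pref e) (sym (+-suc w i)) (i<n∸a⇒a+i<n w j≤)
        ⇐ : ∀ {e} → w + suc i ≤ pref e → suc i ≤ pref e ∸ w
        ⇐ {e} w+j≤ = m+n≤o⇒m≤o∸n (suc i) (subst (_≤ pref e) (+-comm w (suc i)) w+j≤)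
      U⊆ : ∀ {j} → U β j → [ 2 ⋯ m ] j
      U⊆ u = U⇒2≤ β∈ u , proj₂ (proj₁ u)
      ⊆U : ∀ {j} → [ 2 ⋯ m ] j → U β j
      ⊆U {j} (2≤j , j≤m) = Heavy⇒U β∈ (1≤j , j≤m) (subst (λ c → 2 + m ≤ c + j) (sym (count-β 1≤j))
        (+-cancelʳ-≤ w _ _ (begin
          2 + m + w                                               ≡⟨ cong (2 +_) (trans (+-comm m w) (sym t≡)) ⟩
          2 + t′                                                  ≤⟨ block-heavy occupied-w+1 i∈ ⟩
          length (filter (prefers≥? (w + j)) block) + (w + j)     ≡⟨ cong (length (filter (prefers≥? (w + j)) block) +_) (+-comm w j) ⟩
          length (filter (prefers≥? (w + j)) block) + (j + w)     ≡⟨ +-assoc (length (filter (prefers≥? (w + j)) block)) j w ⟨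
          length (filter (prefers≥? (w + j)) block) + j + w       ∎)))
        where
        open ≤-Reasoning
        1≤j : 1 ≤ j
        1≤j = <⇒≤ 2≤j
        i∈ : [ p ⋯ t′ ] (w + j)
        i∈ = subst (_≤ w + j) (+-comm w 2) (+-monoʳ-≤ w 2≤j) , subst (w + j ≤_) (sym t≡) (+-monoʳ-≤ w j≤m)

    -- By contradiction: if p-1 = w+1 stays free, `embed` copies every spot taken on the street of
    -- J, among them spot 1, whose copy is w+1.
    complete⇒preceding : HasCompleteRestriction k α p q → PrecedingSpotOccupied k α p
    complete⇒preceding (J , size<m , bounds , (β∈ , parks) , 2≤m , _) =
      decidable-stable (Occupied? (suc w)) λ free →
        [ (λ ()) , free ∘ subst (λ s → just s ∈ outcomes n k (carsFrom p)) (+-comm w 1) ]′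
          (embed n k m w w+m≤n (p ≤?_) α J (λ j j∈ → proj₁ (bounds j j∈)) bounds (λ ()) (λ ()) free first)
      where
      m : ℕ
      m = ∣ J ∣
      p≤J : VecAll.All (p ≤_) (restrict J α)
      p≤J = lookup⇒restrict J α λ j j∈ → proj₁ (bounds j j∈)
      -- J is contained in the n-p+2 cars preferring p or more, so its segment ends within the
      -- street.
      w+m≤n : w + m ≤ n
      w+m≤n = +-cancelʳ-≤ 2 _ _ (begin
        w + m + 2                            ≡⟨ cong (_+ 2) (+-comm w m) ⟩
        m + w + 2                            ≡⟨ +-assoc m w 2 ⟩
        m + (w + 2)                          ≡⟨ cong (m +_) (+-comm w 2) ⟩
        m + p                                ≤⟨ +-monoˡ-≤ p (∣J∣≤countFrom J α p≤J) ⟩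
        countFrom cars p + p                 ≡⟨ total ⟩
        2 + n                                ≡⟨ +-comm 2 n ⟩
        n + 2                                ∎)
        where open ≤-Reasoning
      first : just 1 ∈ outcomes m k (map (_∸ w) (toList (restrict J α)))
      first = subst (λ bs → just 1 ∈ outcomes m k bs) (Vec.toList-map (_∸ w) (restrict J α))
        (Run.Street.all-park⇒first-occupied m k (toList (τ w (restrict J α))) (VecAll.toList⁺ β∈)
          (Vec.length-toList (τ w (restrict J α))) (≤-trans (s≤s z≤n) 2≤m) parks)

    short⇒preceding : size p q ≤ k → PrecedingSpotOccupied k α p
    short⇒preceding size≤k = short⇒occupied (≤-trans (m≤n+m∸n q (suc w)) (+-monoʳ-≤ (suc w) size≤k))

    all-park⇒preceding : All Is-just (outcomes n k cars) → PrecedingSpotOccupied k α p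
    all-park⇒preceding parks = all-park⇒occupied (all-park-mono (p ≤?_) cars cars∈ id parks)

    preceding⇒interval-occupied : PrecedingSpotOccupied k α p → [ suc w ⋯ q ] x → just x ∈ outcomes n k cars
    preceding⇒interval-occupied occupied-w+1 x∈ with outcomes-mono (p ≤?_) cars cars∈ id (interval-occupied occupied-w+1 x∈)
    ... | inj₂ ox = ox

  open Run n k
  open Street cars cars∈

  last-free : ∀ m → m ≤ n → (∀ {x} → [ suc m ⋯ n ] x → Occupied x) →
    ∃[ s ] s ≤ n × (∀ {x} → [ suc s ⋯ n ] x → Occupied x) × (1 ≤ s → ¬ Occupied s)
  last-free zero    _     above = 0 , z≤n , above , λ ()
  last-free (suc m) 1+m≤n above with Occupied? (suc m)
  ... | no free  = suc m , 1+m≤n , above , λ _ → free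
  ... | yes om = last-free m (<⇒≤ 1+m≤n) λ (m<x , x≤n) →
    [ (λ 1+m<x → above (1+m<x , x≤n)) , (λ { refl → om }) ]′ (m≤n⇒m<n∨m≡n m<x)

  -- The witness s is the last free spot, or 0 if there is none.
  fail⇒Heavy : ∀ {e} → e ∈ entries → spot e ≡ nothing → ∃[ s ] Heavy α (suc s) × (1 ≤ s → ¬ Occupied s × suc s ≤ n)
  fail⇒Heavy {e} e∈ eq with s , s≤n , above , free ← last-free n ≤-refl (λ (n<x , x≤n) → contradiction x≤n (<⇒≱ n<x)) =
    s , subst (λ c → 2 + n ≤ c + suc s) (length-prefers≥ (suc s))
      -- The n-s cars on the spots beyond s all prefer spots beyond s, and so does the failed car:
      -- n-s+1 in total.
      (landings-> (prefers≥? (suc s)) (λ x s<x x≤n →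
        let e , e∈ , eq = occupied⁻ (above (s<x , x≤n)) in e , e∈ , beyond free e∈ eq s<x , eq)
        e∈ (fails-beyond s≤n free) (λ eq′ → contradiction (trans (sym eq) eq′) λ ())) ,
    λ 1≤s → free 1≤s , ≤-trans (fails-beyond s≤n free) (proj₂ (pref-bounds e∈))
    where
    beyond : ∀ {s x e} → (1 ≤ s → ¬ Occupied s) → e ∈ entries → spot e ≡ just x → suc s ≤ x → suc s ≤ pref e
    beyond {zero}  _    e∈ _  _   = proj₁ (pref-bounds e∈)
    beyond {suc s} free e∈ eq s<x = free-above (free (s≤s z≤n)) (s≤s z≤n) e∈ eq s<x
    fails-beyond : ∀ {s} → s ≤ n → (1 ≤ s → ¬ Occupied s) → suc s ≤ pref e
    fails-beyond {zero}  _   _    = proj₁ (pref-bounds e∈)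
    fails-beyond {suc s} s≤n free = ≤-<-trans (m≤m+n (suc s) k) (free-fail (free (s≤s z≤n)) (s≤s z≤n , s≤n) e∈ eq)

  preceding⇒parks : (∀ p q → MaximalInterval (U α) p q → PrecedingSpotOccupied k α p) → All Is-just (outcomes n k cars)
  preceding⇒parks preceding = All.tabulate λ {m} → park-all m
    where
    no-failure : ∀ {e} → e ∈ entries → spot e ≢ nothing
    no-failure e∈ eq with fail⇒Heavy e∈ eq
    -- No spot is free, and 1 would be heavy, which takes n+1 cars.
    ... | zero , heavy , _ = contradiction heavy (¬Heavy-1 α∈)
    ... | suc s , heavy , last with free , 2+s≤n ← last (s≤s z≤n)
        with p , q , max , p≤ , ≤q ← maximal-interval (U? α∈) (λ { ((() , _) , _) }) (proj₂ ∘ proj₁) (Heavy⇒U α∈ (s≤s z≤n , 2+s≤n) heavy)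
        with w , refl , interval ← intervalData p q max =
        -- The successor of the last free spot lies in [p,q], so the free spot itself lies in
        -- [p-1,q], which is fully occupied.
        free (preceding⇒interval-occupied interval (preceding p q max) (s≤s⁻¹ p≤ , <⇒≤ ≤q))
    park-all : ∀ m → m ∈ outcomes n k cars → Is-just m
    park-all (just _) _ = MaybeAny.just tt
    park-all nothing  m∈ with e , e∈ , eq ← ∈-map⁻ spot (subst (nothing ∈_) (outcomes-log [] cars) m∈) =
      contradiction (sym eq) (no-failure e∈)

theorem5p1 : ∀ {n} (k : ℕ) (α : Vec ℕ n) → 1 ≤ k → IsPP α →
    (∀ p q → MaximalInterval (U α) p q →
    (PrecedingSpotOccupied k α p ⇔ HasCompleteRestriction k α p q)
    × (size p q ≤ k → PrecedingSpotOccupied k α p × HasCompleteRestriction k α p q))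
    × (PF k α ⇔ (∀ p q → MaximalInterval (U α) p q → suc k ≤ size p q → PrecedingSpotOccupied k α p))
    × (PF k α ⇔ (∀ p q → MaximalInterval (U α) p q → suc k ≤ size p q → HasCompleteRestriction k α p q))
theorem5p1 {n} k α _ α∈ =
  (λ p q max → mk⇔ (i⇒ii p q max) (ii⇒i p q max) , λ short → i p q max short , i⇒ii p q max (i p q max short)) ,
  mk⇔ (λ pf p q max _ → pf⇒i pf p q max) i⇒pf ,
  mk⇔ (λ pf p q max _ → i⇒ii p q max (pf⇒i pf p q max)) (λ long → i⇒pf λ p q max size>k → ii⇒i p q max (long p q max size>k))
  where
  i⇒ii : ∀ p q → MaximalInterval (U α) p q → PrecedingSpotOccupied k α p → HasCompleteRestriction k α p q
  i⇒ii p q max with w , refl , interval ← intervalData k α α∈ p q max = preceding⇒complete k α α∈ interval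
  ii⇒i : ∀ p q → MaximalInterval (U α) p q → HasCompleteRestriction k α p q → PrecedingSpotOccupied k α p
  ii⇒i p q max with w , refl , interval ← intervalData k α α∈ p q max = complete⇒preceding k α α∈ interval
  i : ∀ p q → MaximalInterval (U α) p q → size p q ≤ k → PrecedingSpotOccupied k α p
  i p q max with w , refl , interval ← intervalData k α α∈ p q max = short⇒preceding k α α∈ interval
  pf⇒i : PF k α → ∀ p q → MaximalInterval (U α) p q → PrecedingSpotOccupied k α p
  pf⇒i (_ , parks) p q max with w , refl , interval ← intervalData k α α∈ p q max = all-park⇒preceding k α α∈ interval parks
  i⇒pf : (∀ p q → MaximalInterval (U α) p q → suc k ≤ size p q → PrecedingSpotOccupied k α p) → PF k α
  -- Intervals of size at most k satisfy (i) by themselves, so the assumption on the long ones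
  -- yields (i) for all.
  i⇒pf long = α∈ , preceding⇒parks k α α∈ λ p q max → [ long p q max , i p q max ]′ (<-≤-connex k (size p q))
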